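{- There exist absolute constants $c_*>0$ and $K>0$ such that for every integer $d\geqslant 1$, $$\bigl| i(H^{mod}_d) - 3\cdot 4^d - d\cdot 3^{d+1}\bigr| \leqslant K(3-c_*)^d .$$ In particular, $i(H^{mod}_d) = 3\cdot 4^d + O((4-c_*)^d)$.
   Context: For a hypergraph $H=(V,E)$, a set $W\subseteq V$ is independent if no edge $e\in E$ satisfies $e\subseteq W$; $i(H)$ denotes the number of independent sets of $H$ (the empty set included). The hypergraph $H^{mod}_d=(V,E)$ has vertex set $V=V_1\sqcup V_2\sqcup V_3$, where each $V_i$ is a disjoint copy of the cyclic group $\mathbb{Z}/d\mathbb{Z}$, and edge set $E=\{\{x,y,z\}: x\in V_1,\ y\in V_2,\ z\in V_3,\ x+y\equiv z \pmod d\}$. It is $3$-uniform, $d$-regular and linear. -}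

module Defs where

open import Algebra.Definitions.RawSemiring using () renaming (_^_ to pow)
open import Data.Bool.Properties using () renaming (_≟_ to _≟ᵇ_)
open import Data.Fin.Base using (Fin; toℕ; _↑ˡ_; _↑ʳ_)
open import Data.Fin.Properties using (any?)
open import Data.Fin.Subset using (Subset; inside; outside; ⁅_⁆; _∪_; _⊆_)
open import Data.Fin.Subset.Properties using (_⊆?_; anySubset?)
open import Data.Integer.Base using (+_)
open import Data.List.Base using (List; []; _∷_; _++_; map; filter; length)
open import Data.Nat.Base using (ℕ; zero; suc; _+_; NonZero)
open import Data.Nat.DivMod using (_%_)
open import Data.Nat.Properties using () renaming (_≟_ to _≟ⁿ_)
open import Data.Product.Base using (_×_; ∃-syntax; Σ-syntax)
open import Data.Rational.Base using (ℚ; _/_; +-*-rawSemiring)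
open import Data.Vec.Base using ([]; _∷_)
open import Data.Vec.Properties using (≡-dec)
open import Level using (0ℓ)
open import Relation.Binary.PropositionalEquality using (_≡_)
open import Relation.Nullary.Decidable using (_×-dec_; ¬?)
open import Relation.Nullary.Negation using (¬_)
open import Relation.Unary using (Pred; Decidable)

-- Decidability of the edge set is needed only for counting.

record Hypergraph (n : ℕ) : Set₁ where
  field
    Edge  : Pred (Subset n) 0ℓ
    edge? : Decidable Edge

open Hypergraph public

Independent : ∀ {n} → Hypergraph n → Pred (Subset n) 0ℓ
Independent H W = ¬ (∃[ e ] (Edge H e × e ⊆ W))

independent? : ∀ {n} (H : Hypergraph n) → Decidable (Independent H)
independent? H W = ¬? (anySubset? (λ e → edge? H e ×-dec e ⊆? W))

subsets : ∀ n → List (Subset n)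
subsets zero    = [] ∷ []
subsets (suc n) = map (outside ∷_) (subsets n) ++ map (inside ∷_) (subsets n)

i : ∀ {n} → Hypergraph n → ℕ
i {n} H = length (filter (independent? H) (subsets n))

-- The vertex set V₁ ⊔ V₂ ⊔ V₃ is Fin (d + (d + d)); residues modulo d are
-- represented by Fin d.

module _ {d : ℕ} where

  V₁ V₂ V₃ : Fin d → Fin (d + (d + d))
  V₁ x = x ↑ˡ (d + d)
  V₂ y = d ↑ʳ (y ↑ˡ d)
  V₃ z = d ↑ʳ (d ↑ʳ z)

  triple : Fin d → Fin d → Fin d → Subset (d + (d + d))
  triple x y z = ⁅ V₁ x ⁆ ∪ ⁅ V₂ y ⁆ ∪ ⁅ V₃ z ⁆

Hmod : ∀ d .{{_ : NonZero d}} → Hypergraph (d + (d + d))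
Hmod d = record
  { Edge  = λ e → Σ[ x ∈ Fin d ] Σ[ y ∈ Fin d ] Σ[ z ∈ Fin d ]
              ((toℕ x + toℕ y) % d ≡ toℕ z % d × e ≡ triple x y z)
  ; edge? = λ e → any? λ x → any? λ y → any? λ z →
              ((toℕ x + toℕ y) % d ≟ⁿ toℕ z % d) ×-dec
              ≡-dec _≟ᵇ_ e (triple x y z)
  }

fromℕ : ℕ → ℚ
fromℕ n = + n / 1

infixr 8 _^ℚ_

_^ℚ_ : ℚ → ℕ → ℚ
_^ℚ_ = pow +-*-rawSemiring

{-# OPTIONS --safe #-}

-- An independent set is a triple (A, B, C) with C disjoint from A + B.  The triples with some
-- part of size at most 1 give the main term 3 (4^d + d 3^d), up to overlaps of order d² 2^d.
--
-- If A has two elements, (B, C) is an independent set of a union of even cycles of length at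
-- least 4 on 2d vertices.  Cutting out paths on 4 vertices (8 independent sets instead of 9)
-- bounds the number of such pairs by 72^(d/4), and 72^(1/4) < 2.94.  This settles the triples
-- with a part of bounded size at least 2.
--
-- If all parts have at least k elements, fix k-subsets T₁ ⊆ A, T₂ ⊆ B, T₃ ⊆ C: at the price of
-- a factor polynomial in d, (A, B, C) becomes an independent set of a graph on 3d vertices that
-- is k-regular between any two of the three sides.  Branching on vertices of degree at least s
-- costs a factor 1 + o(1) per vertex for large s.  When no such vertex is left, double counting
-- shows that about 3d/2 vertices remain if s is small compared to k.  The resulting bound,
-- about 2^(3d/2), suffices because 2^(3/2) < 3.
--
-- Only the Latin square property of addition modulo d is used.

module Submission where

open import Defs
open import Data.Nat.Base as ℕ using (ℕ; zero; suc; NonZero)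
open import Data.Nat.Properties as ℕₚ using ()
open import Data.Nat.Tactic.RingSolver using (solve-∀)
open import Data.Product.Base using (_×_; _,_; ∃; ∃₂; Σ-syntax; proj₁; proj₂)
open import Data.Sum.Base using (_⊎_; inj₁; inj₂)
open import Relation.Binary.PropositionalEquality

-- For a single `A` with at least two elements the pairs `(B, C)` number at most about `2.94^d`.
-- There are `2^d` sets `A`, so this bound can only be summed while polynomially many of them are in
-- play. If every part is large, fixing a whole part is too expensive; a bounded piece of each part
-- costs only a polynomial factor and already forces many conflicts. All estimates stay in ℕ: a
-- growth rate `p/q` appears as `t * q^d ≤ p^d`. The common denominator is 50. The numerators are
-- 147 when a part with two elements is fixed, 148 when all parts are large, and 149 once polynomial
-- factors are absorbed. Since `149/50 = 3 - 1/50` and `199/50 = 4 - 1/50`, the constant `c` is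
-- `1/50` in both claims.

module Counting where

  open import Data.Bool.Base using (true; false; if_then_else_)
  import Data.Bool.Properties as Boolₚ
  open import Data.Empty using (⊥-elim) renaming (⊥ to ∅)
  open import Data.Fin.Base using (Fin; zero; suc; toℕ; _↑ˡ_; _↑ʳ_)
  open import Data.Fin.Properties as Finₚ using (any?; all?)
  open import Data.Fin.Subset using (Subset; inside; outside; ⁅_⁆; ⊥; ⊤; _∈_; _∉_; _⊆_; _∪_; _-_; Nonempty) renaming (∣_∣ to card)
  open import Data.Fin.Subset.Properties
  open import Data.List.Base using (List; []; _∷_; _++_; map; filter; length; allFin)
  open import Data.List.Membership.Propositional using () renaming (_∈_ to _∈ˡ_)
  open import Data.List.Membership.Propositional.Properties using (∈-map⁺; ∈-++⁺ˡ; ∈-++⁺ʳ)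
  open import Data.List.Properties using (map-tabulate; length-tabulate)
  open import Data.List.Relation.Unary.Any using (here; there)
  open import Data.Nat.Base using (_+_; _*_; _^_; _∸_; _≤_; _<_; z≤n; s≤s)
  open import Data.Nat.DivMod using (_/_; _%_; _mod_; m/n*n≤m; /-monoˡ-≤; m*n/n≡m; %-distribˡ-+; [m+n]%n≡m%n; m<n⇒m%n≡m; m%n%n≡m%n; m%n<n)
  open import Data.Nat.Properties using (_≤?_; _≟_)
  open import Data.Vec.Base as Vec using ([]; _∷_; here; there; _[_]≔_)
  open import Data.Vec.Properties using (≡-dec; ∷-injectiveʳ; lookup⇒[]=; []=⇒lookup; lookup∘tabulate; lookup-++ˡ; lookup-++ʳ; []≔-updates; []≔-minimal; []≔-idempotent; []=-injective)
  open import Function.Base using (_∘_; id)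
  open import Relation.Binary.Definitions using (DecidableEquality)
  open import Relation.Nullary
  open import Relation.Nullary.Decidable using (dec-true)

  -- Finite sums

  ∑ : {A : Set} → List A → (A → ℕ) → ℕ
  ∑ []       f = 0
  ∑ (x ∷ xs) f = f x + ∑ xs f

  infix 5 ∑
  syntax ∑ xs (λ x → e) = ∑[ x ← xs ] e

  module _ {A : Set} where

    ∑-mono : (xs : List A) {f g : A → ℕ} → (∀ x → f x ≤ g x) → ∑ xs f ≤ ∑ xs g
    ∑-mono []       f≤g = z≤n
    ∑-mono (x ∷ xs) f≤g = ℕₚ.+-mono-≤ (f≤g x) (∑-mono xs f≤g)

    ∑-cong : (xs : List A) {f g : A → ℕ} → (∀ x → f x ≡ g x) → ∑ xs f ≡ ∑ xs g
    ∑-cong []       f≡g = refl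
    ∑-cong (x ∷ xs) f≡g = cong₂ _+_ (f≡g x) (∑-cong xs f≡g)

    ∑-+ : (xs : List A) (f g : A → ℕ) → ∑ xs (λ x → f x + g x) ≡ ∑ xs f + ∑ xs g
    ∑-+ []       f g = refl
    ∑-+ (x ∷ xs) f g rewrite ∑-+ xs f g = lemma (f x) (g x) (∑ xs f) (∑ xs g)
      where
      lemma : ∀ a b c d → a + b + (c + d) ≡ a + c + (b + d)
      lemma = solve-∀

    ∑-*ˡ : (xs : List A) (c : ℕ) (f : A → ℕ) → ∑ xs (λ x → c * f x) ≡ c * ∑ xs f
    ∑-*ˡ []       c f = sym (ℕₚ.*-zeroʳ c)
    ∑-*ˡ (x ∷ xs) c f rewrite ∑-*ˡ xs c f = sym (ℕₚ.*-distribˡ-+ c (f x) _)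

    ∑-*ʳ : (xs : List A) (c : ℕ) (f : A → ℕ) → ∑ xs (λ x → f x * c) ≡ ∑ xs f * c
    ∑-*ʳ []       c f = refl
    ∑-*ʳ (x ∷ xs) c f rewrite ∑-*ʳ xs c f = sym (ℕₚ.*-distribʳ-+ c (f x) _)

    ∑-const : (xs : List A) (c : ℕ) → ∑ xs (λ _ → c) ≡ length xs * c
    ∑-const []       c = refl
    ∑-const (x ∷ xs) c = cong (c +_) (∑-const xs c)

    ∑-zero : (xs : List A) → ∑[ _ ← xs ] 0 ≡ 0
    ∑-zero []       = refl
    ∑-zero (_ ∷ xs) = ∑-zero xs

    ∑-++ : (xs ys : List A) (f : A → ℕ) → ∑ (xs ++ ys) f ≡ ∑ xs f + ∑ ys f
    ∑-++ []       ys f = refl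
    ∑-++ (x ∷ xs) ys f rewrite ∑-++ xs ys f = sym (ℕₚ.+-assoc (f x) _ _)

    ≤∑ : {xs : List A} {y : A} (f : A → ℕ) → y ∈ˡ xs → f y ≤ ∑ xs f
    ≤∑ f (here refl)  = ℕₚ.m≤m+n _ _
    ≤∑ f (there y∈xs) = ℕₚ.m≤n⇒m≤o+n _ (≤∑ f y∈xs)

  ∑-map : {A B : Set} (h : A → B) (xs : List A) (f : B → ℕ) → ∑ (map h xs) f ≡ ∑ xs (f ∘ h)
  ∑-map h []       f = refl
  ∑-map h (x ∷ xs) f = cong (f (h x) +_) (∑-map h xs f)

  ∑-swap : {A B : Set} (xs : List A) (ys : List B) (f : A → B → ℕ) →
           ∑[ x ← xs ] ∑[ y ← ys ] f x y ≡ ∑[ y ← ys ] ∑[ x ← xs ] f x y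
  ∑-swap []       ys f = sym (∑-zero ys)
  ∑-swap (x ∷ xs) ys f rewrite ∑-swap xs ys f = sym (∑-+ ys (f x) _)

  ∑-allFin-suc : ∀ n (f : Fin (suc n) → ℕ) → ∑ (allFin (suc n)) f ≡ f zero + ∑ (allFin n) (f ∘ suc)
  ∑-allFin-suc n f = cong (f zero +_)
    (trans (cong (λ xs → ∑ xs f) (sym (map-tabulate id suc))) (∑-map suc (allFin n) f))

  ∑-subsets-suc : ∀ n (f : Subset (suc n) → ℕ) →
    ∑ (subsets (suc n)) f ≡ ∑ (subsets n) (f ∘ (outside ∷_)) + ∑ (subsets n) (f ∘ (inside ∷_))
  ∑-subsets-suc n f = trans (∑-++ (map (outside ∷_) (subsets n)) _ f)
    (cong₂ _+_ (∑-map _ (subsets n) f) (∑-map _ (subsets n) f))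

  ∑-subsets-+ : ∀ m n (f : Subset (m + n) → ℕ) →
    ∑ (subsets (m + n)) f ≡ ∑[ A ← subsets m ] ∑[ B ← subsets n ] f (A Vec.++ B)
  ∑-subsets-+ zero    n f = sym (ℕₚ.+-identityʳ _)
  ∑-subsets-+ (suc m) n f = begin
    ∑ (subsets (suc m + n)) f
      ≡⟨ ∑-subsets-suc (m + n) f ⟩
    ∑ (subsets (m + n)) (f ∘ (outside ∷_)) + ∑ (subsets (m + n)) (f ∘ (inside ∷_))
      ≡⟨ cong₂ _+_ (∑-subsets-+ m n _) (∑-subsets-+ m n _) ⟩
    ∑ (subsets m) (g ∘ (outside ∷_)) + ∑ (subsets m) (g ∘ (inside ∷_))
      ≡⟨ ∑-subsets-suc m g ⟨
    ∑ (subsets (suc m)) g ∎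
    where
    open ≡-Reasoning
    g : Subset (suc m) → ℕ
    g A = ∑[ B ← subsets n ] f (A Vec.++ B)

  length-subsets : ∀ n → length (subsets n) ≡ 2 ^ n
  length-subsets n = trans (trans (sym (ℕₚ.*-identityʳ _)) (sym (∑-const (subsets n) 1))) (go n)
    where
    go : ∀ n → ∑ (subsets n) (λ _ → 1) ≡ 2 ^ n
    go zero    = refl
    go (suc n) rewrite ∑-subsets-suc n (λ _ → 1) | go n = cong (2 ^ n +_) (sym (ℕₚ.+-identityʳ _))

  ∈-subsets : ∀ {n} (A : Subset n) → A ∈ˡ subsets n
  ∈-subsets []            = here refl
  ∈-subsets (outside ∷ A) = ∈-++⁺ˡ (∈-map⁺ (outside ∷_) (∈-subsets A))
  ∈-subsets {suc n} (inside ∷ A) =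
    ∈-++⁺ʳ (map (outside ∷_) (subsets n)) (∈-map⁺ (inside ∷_) (∈-subsets A))

  -- Indicators, enumerations and reindexing of sums

  𝟙 : {P : Set} → Dec P → ℕ
  𝟙 p = if does p then 1 else 0

  module _ {P : Set} where

    𝟙-yes : (p : Dec P) → P → 𝟙 p ≡ 1
    𝟙-yes (yes _) _ = refl
    𝟙-yes (no ¬p) p = ⊥-elim (¬p p)

    𝟙-no : (p : Dec P) → ¬ P → 𝟙 p ≡ 0
    𝟙-no (yes p) ¬p = ⊥-elim (¬p p)
    𝟙-no (no _)  _  = refl

    𝟙≤1 : (p : Dec P) → 𝟙 p ≤ 1
    𝟙≤1 (yes _) = s≤s z≤n
    𝟙≤1 (no _)  = z≤n

    𝟙≤ : (p : Dec P) {n : ℕ} → (P → 1 ≤ n) → 𝟙 p ≤ n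
    𝟙≤ (yes p) h = h p
    𝟙≤ (no _)  h = z≤n

  𝟙-mono : {P Q : Set} (p : Dec P) (q : Dec Q) → (P → Q) → 𝟙 p ≤ 𝟙 q
  𝟙-mono p q h = 𝟙≤ p (λ x → ℕₚ.≤-reflexive (sym (𝟙-yes q (h x))))

  𝟙-cong : {P Q : Set} (p : Dec P) (q : Dec Q) → (P → Q) → (Q → P) → 𝟙 p ≡ 𝟙 q
  𝟙-cong p q f g = ℕₚ.≤-antisym (𝟙-mono p q f) (𝟙-mono q p g)

  𝟙-¬ : {P : Set} (p : Dec P) → 𝟙 p + 𝟙 (¬? p) ≡ 1
  𝟙-¬ (yes _) = refl
  𝟙-¬ (no _)  = refl

  𝟙-× : {P Q : Set} (p : Dec P) (q : Dec Q) → 𝟙 (p ×-dec q) ≡ 𝟙 p * 𝟙 q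
  𝟙-× (yes _) (yes _) = refl
  𝟙-× (yes _) (no _)  = refl
  𝟙-× (no _)  q       = refl

  length-filter : {A : Set} {P : A → Set} (P? : ∀ x → Dec (P x)) (xs : List A) →
                  length (filter P? xs) ≡ ∑[ x ← xs ] 𝟙 (P? x)
  length-filter P? []       = refl
  length-filter P? (x ∷ xs) with does (P? x)
  ... | true  = cong suc (length-filter P? xs)
  ... | false = length-filter P? xs

  _≟ˢ_ : ∀ {n} → DecidableEquality (Subset n)
  _≟ˢ_ = ≡-dec Boolₚ._≟_

  -- Multiplicity one, written as a sum of indicators: the form in which an exchange of summations
  -- can use it.
  Enumerates : {A : Set} → DecidableEquality A → List A → Set
  Enumerates _≟_ xs = ∀ y → ∑[ x ← xs ] 𝟙 (x ≟ y) ≡ 1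

  allFin-enumerates : ∀ n → Enumerates (Finₚ._≟_ {n}) (allFin n)
  allFin-enumerates (suc n) zero = trans (∑-allFin-suc n (λ x → 𝟙 (x Finₚ.≟ zero))) (cong suc
    (trans (∑-cong (allFin n) (λ x → 𝟙-no (suc x Finₚ.≟ zero) λ ()))
    (∑-zero (allFin n))))
  allFin-enumerates (suc n) (suc y) = trans (∑-allFin-suc n (λ x → 𝟙 (x Finₚ.≟ suc y)))
    (trans (∑-cong (allFin n) (λ x → 𝟙-cong (suc x Finₚ.≟ suc y) (x Finₚ.≟ y) Finₚ.suc-injective (cong suc)))
    (allFin-enumerates n y))

  subsets-enumerates : ∀ n → Enumerates (_≟ˢ_ {n}) (subsets n)
  subsets-enumerates zero    [] = refl
  subsets-enumerates (suc n) (s ∷ B) = trans (∑-subsets-suc n _) (go s)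
    where
    same : ∀ s → ∑[ A ← subsets n ] 𝟙 ((s ∷ A) ≟ˢ (s ∷ B)) ≡ 1
    same s = trans (∑-cong (subsets n) (λ A → 𝟙-cong ((s ∷ A) ≟ˢ (s ∷ B)) (A ≟ˢ B) ∷-injectiveʳ (cong (s ∷_))))
                   (subsets-enumerates n B)
    diff : ∀ s t → s ≢ t → ∑[ A ← subsets n ] 𝟙 ((s ∷ A) ≟ˢ (t ∷ B)) ≡ 0
    diff s t s≢t = trans (∑-cong (subsets n) (λ A → 𝟙-no ((s ∷ A) ≟ˢ (t ∷ B)) λ { refl → s≢t refl }))
                         (∑-zero (subsets n))
    go : ∀ s → ∑ (subsets n) (λ A → 𝟙 ((outside ∷ A) ≟ˢ (s ∷ B)))
             + ∑ (subsets n) (λ A → 𝟙 ((inside ∷ A) ≟ˢ (s ∷ B))) ≡ 1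
    go outside = cong₂ _+_ (same outside) (diff inside outside λ ())
    go inside  = cong₂ _+_ (diff outside inside λ ()) (same inside)

  module _ {A : Set} (_≟_ : DecidableEquality A) (xs : List A) (enum : Enumerates _≟_ xs) where

    private
      pick : (y : A) (f : A → ℕ) → ∑[ x ← xs ] 𝟙 (x ≟ y) * f x ≡ f y
      pick y f = begin
        ∑[ x ← xs ] 𝟙 (x ≟ y) * f x ≡⟨ ∑-cong xs (λ x → go x) ⟩
        ∑[ x ← xs ] 𝟙 (x ≟ y) * f y ≡⟨ ∑-*ʳ xs (f y) _ ⟩
        (∑[ x ← xs ] 𝟙 (x ≟ y)) * f y ≡⟨ cong (_* f y) (enum y) ⟩
        1 * f y                     ≡⟨ ℕₚ.*-identityˡ (f y) ⟩
        f y ∎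
        where
        open ≡-Reasoning
        go : ∀ x → 𝟙 (x ≟ y) * f x ≡ 𝟙 (x ≟ y) * f y
        go x with x ≟ y
        ... | yes refl = refl
        ... | no _     = refl

    -- Both sides equal the double sum of `f y` over the pairs with `y ≡ φ x`, which is the same
    -- condition as `x ≡ ψ y`; summing in either order replaces any argument about permutations of
    -- lists.
    ∑-reindex : (φ ψ : A → A) → (∀ x → ψ (φ x) ≡ x) → (∀ y → φ (ψ y) ≡ y) →
                (f : A → ℕ) → ∑[ x ← xs ] f (φ x) ≡ ∑ xs f
    ∑-reindex φ ψ ψφ φψ f = begin
      ∑[ x ← xs ] f (φ x)
        ≡⟨ ∑-cong xs (λ x → pick (φ x) f) ⟨
      ∑[ x ← xs ] ∑[ y ← xs ] 𝟙 (y ≟ φ x) * f y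
        ≡⟨ ∑-swap xs xs _ ⟩
      ∑[ y ← xs ] ∑[ x ← xs ] 𝟙 (y ≟ φ x) * f y
        ≡⟨ ∑-cong xs (λ y → trans (∑-*ʳ xs (f y) _) (cong (_* f y) (∑-cong xs (λ x →
             𝟙-cong (y ≟ φ x) (x ≟ ψ y) (λ { refl → sym (ψφ x) }) (λ { refl → sym (φψ y) }))))) ⟩
      ∑[ y ← xs ] (∑[ x ← xs ] 𝟙 (x ≟ ψ y)) * f y
        ≡⟨ ∑-cong xs (λ y → trans (cong (_* f y) (enum (ψ y))) (ℕₚ.*-identityˡ (f y))) ⟩
      ∑ xs f ∎
      where open ≡-Reasoning

  -- The subsets are paired by their membership of `x`. Both values of `f` on a pair are charged to
  -- the member without `x`, and the values of `g` on sets containing `x` are extra. This is the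
  -- summation pattern of branching on `x`.
  ∑-fibre : ∀ {n} (x : Fin n) (f g : Subset n → ℕ) →
    (∀ A → f (A [ x ]≔ outside) + f (A [ x ]≔ inside) ≤ g (A [ x ]≔ outside)) →
    ∑ (subsets n) f ≤ ∑ (subsets n) g
  ∑-fibre {suc n} zero f g f≤g = begin
    ∑ (subsets (suc n)) f
      ≡⟨ ∑-subsets-suc n f ⟩
    ∑ (subsets n) (f ∘ (outside ∷_)) + ∑ (subsets n) (f ∘ (inside ∷_))
      ≡⟨ ∑-+ (subsets n) _ _ ⟨
    ∑[ A ← subsets n ] (f (outside ∷ A) + f (inside ∷ A))
      ≤⟨ ∑-mono (subsets n) (λ A → f≤g (outside ∷ A)) ⟩
    ∑ (subsets n) (g ∘ (outside ∷_))
      ≤⟨ ℕₚ.m≤m+n _ _ ⟩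
    ∑ (subsets n) (g ∘ (outside ∷_)) + ∑ (subsets n) (g ∘ (inside ∷_))
      ≡⟨ ∑-subsets-suc n g ⟨
    ∑ (subsets (suc n)) g ∎
    where open ℕₚ.≤-Reasoning
  ∑-fibre {suc n} (suc x) f g f≤g = begin
    ∑ (subsets (suc n)) f
      ≡⟨ ∑-subsets-suc n f ⟩
    ∑ (subsets n) (f ∘ (outside ∷_)) + ∑ (subsets n) (f ∘ (inside ∷_))
      ≤⟨ ℕₚ.+-mono-≤ (∑-fibre x _ _ (f≤g ∘ (outside ∷_))) (∑-fibre x _ _ (f≤g ∘ (inside ∷_))) ⟩
    ∑ (subsets n) (g ∘ (outside ∷_)) + ∑ (subsets n) (g ∘ (inside ∷_))
      ≡⟨ ∑-subsets-suc n g ⟨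
    ∑ (subsets (suc n)) g ∎
    where open ℕₚ.≤-Reasoning

  -- Counting subsets by size, inclusion and disjointness

  ∑-⊆ : ∀ {n} (X : Subset n) → ∑[ A ← subsets n ] 𝟙 (A ⊆? X) ≡ 2 ^ card X
  ∑-⊆ [] = refl
  ∑-⊆ {suc n} (s ∷ X) = trans (∑-subsets-suc n (λ A → 𝟙 (A ⊆? (s ∷ X)))) (go s)
    where
    same : ∀ s t → (∀ A → A ⊆ X → (s ∷ A) ⊆ (t ∷ X)) →
           ∑[ A ← subsets n ] 𝟙 ((s ∷ A) ⊆? (t ∷ X)) ≡ 2 ^ card X
    same s t h = trans (∑-cong (subsets n) λ A → 𝟙-cong ((s ∷ A) ⊆? (t ∷ X)) (A ⊆? X) drop-∷-⊆ (h A)) (∑-⊆ X)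
    go : ∀ t → (∑[ A ← subsets n ] 𝟙 ((outside ∷ A) ⊆? (t ∷ X)))
             + (∑[ A ← subsets n ] 𝟙 ((inside ∷ A) ⊆? (t ∷ X))) ≡ 2 ^ card (t ∷ X)
    go inside = cong₂ _+_ (same outside inside λ _ → out⊆)
      (trans (same inside inside λ _ → in⊆in) (sym (ℕₚ.+-identityʳ _)))
    go outside = trans (cong₂ _+_ (same outside outside λ _ → out⊆)
      (trans (∑-cong (subsets n) (λ A → 𝟙-no ((inside ∷ A) ⊆? (outside ∷ X)) λ p → contradiction (p here) λ ()))
        (∑-zero (subsets n)))) (ℕₚ.+-identityʳ _)

  card-∑ : ∀ {n} (A : Subset n) → ∑[ x ← allFin n ] 𝟙 (x ∈? A) ≡ card A
  card-∑ [] = refl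
  card-∑ {suc n} (s ∷ A) = trans (∑-allFin-suc n (λ x → 𝟙 (x ∈? (s ∷ A)))) (trans
    (cong (𝟙 (zero ∈? (s ∷ A)) +_) (trans
      (∑-cong (allFin n) (λ x → 𝟙-cong (suc x ∈? (s ∷ A)) (x ∈? A) drop-there there)) (card-∑ A)))
    (go s))
    where
    go : ∀ s → 𝟙 (zero ∈? (s ∷ A)) + card A ≡ card (s ∷ A)
    go inside  = refl
    go outside = refl

  ∑-allFin-1 : ∀ n → ∑[ _ ← allFin n ] 1 ≡ n
  ∑-allFin-1 n = trans (∑-const (allFin n) 1) (trans (ℕₚ.*-identityʳ _) (length-tabulate id))

  module _ {n} {P : Fin n → Set} (P? : ∀ x → Dec (P x)) where

    ⟦_⟧ : Subset n
    ⟦_⟧ = Vec.tabulate (does ∘ P?)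

    ∈⟦⟧⁺ : ∀ {x} → P x → x ∈ ⟦_⟧
    ∈⟦⟧⁺ {x} Px = lookup⇒[]= x ⟦_⟧ (trans (lookup∘tabulate _ x) (dec-true (P? x) Px))

    ∈⟦⟧⁻ : ∀ {x} → x ∈ ⟦_⟧ → P x
    ∈⟦⟧⁻ {x} x∈ = toWitness' (P? x) (trans (sym (lookup∘tabulate _ x)) ([]=⇒lookup x∈))
      where
      toWitness' : ∀ {Q : Set} (q : Dec Q) → does q ≡ true → Q
      toWitness' (yes q) _ = q

    card-⟦⟧ : card ⟦_⟧ ≡ ∑[ x ← allFin n ] 𝟙 (P? x)
    card-⟦⟧ = trans (sym (card-∑ ⟦_⟧)) (∑-cong (allFin n) λ x → 𝟙-cong (x ∈? ⟦_⟧) (P? x) ∈⟦⟧⁻ ∈⟦⟧⁺)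

  -- A crude polynomial bound suffices. Splitting by membership of the first point gives Pascal's
  -- recursion, and `(n+1)^(k+1) + (n+1)^k = (n+2) (n+1)^k ≤ (n+2)^(k+1)`.
  ∑-card≤ : ∀ n k → ∑[ A ← subsets n ] 𝟙 (card A ≤? k) ≤ suc n ^ k
  ∑-card≤ zero    k = ℕₚ.≤-trans (ℕₚ.≤-reflexive (ℕₚ.+-identityʳ _))
    (ℕₚ.≤-trans (𝟙≤1 (0 ≤? k)) (ℕₚ.m^n>0 1 k))
  ∑-card≤ (suc n) k = ℕₚ.≤-trans (ℕₚ.≤-reflexive (∑-subsets-suc n (λ A → 𝟙 (card A ≤? k)))) (go k)
    where
    go : ∀ k → (∑[ A ← subsets n ] 𝟙 (card A ≤? k)) + (∑[ A ← subsets n ] 𝟙 (suc (card A) ≤? k))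
               ≤ suc (suc n) ^ k
    go zero = begin
      (∑[ A ← subsets n ] 𝟙 (card A ≤? 0)) + (∑[ A ← subsets n ] 𝟙 (suc (card A) ≤? 0))
        ≤⟨ ℕₚ.+-mono-≤ (∑-card≤ n 0) (ℕₚ.≤-reflexive (trans
             (∑-cong (subsets n) λ A → 𝟙-no (suc (card A) ≤? 0) λ ())
             (∑-zero (subsets n)))) ⟩
      1 ∎
      where open ℕₚ.≤-Reasoning
    go (suc k) = begin
      (∑[ A ← subsets n ] 𝟙 (card A ≤? suc k)) + (∑[ A ← subsets n ] 𝟙 (suc (card A) ≤? suc k))
        ≤⟨ ℕₚ.+-mono-≤ (∑-card≤ n (suc k)) (ℕₚ.≤-trans (ℕₚ.≤-reflexive
            (∑-cong (subsets n) λ A → 𝟙-cong (suc (card A) ≤? suc k) (card A ≤? k) ℕ.s≤s⁻¹ s≤s))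
            (∑-card≤ n k)) ⟩
      suc n * suc n ^ k + suc n ^ k
        ≡⟨ ℕₚ.+-comm (suc n * suc n ^ k) _ ⟩
      suc (suc n) * suc n ^ k
        ≤⟨ ℕₚ.*-monoʳ-≤ (suc (suc n)) (ℕₚ.^-monoˡ-≤ k (ℕₚ.n≤1+n (suc n))) ⟩
      suc (suc n) * suc (suc n) ^ k ∎
      where open ℕₚ.≤-Reasoning

  ∑-card≤0 : ∀ n (h : Subset n → ℕ) → ∑[ A ← subsets n ] 𝟙 (card A ≤? 0) * h A ≡ h ⊥
  ∑-card≤0 zero    h = trans (ℕₚ.+-identityʳ _) (ℕₚ.+-identityʳ _)
  ∑-card≤0 (suc n) h = trans (∑-subsets-suc n (λ A → 𝟙 (card A ≤? 0) * h A)) (trans (cong₂ _+_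
    (∑-card≤0 n (h ∘ (outside ∷_)))
    (trans (∑-cong (subsets n) λ A → cong (_* h (inside ∷ A)) (𝟙-no (suc (card A) ≤? 0) λ ()))
      (∑-zero (subsets n)))) (ℕₚ.+-identityʳ _))

  -- An identity for an arbitrary weight `h`, because the parts of size at most 1 must yield the
  -- main term exactly.
  ∑-card≤1 : ∀ n (h : Subset n → ℕ) →
    ∑[ A ← subsets n ] 𝟙 (card A ≤? 1) * h A ≡ h ⊥ + (∑[ x ← allFin n ] h ⁅ x ⁆)
  ∑-card≤1 zero    h = ℕₚ.+-identityʳ _
  ∑-card≤1 (suc n) h = begin
    ∑[ A ← subsets (suc n) ] 𝟙 (card A ≤? 1) * h A
      ≡⟨ ∑-subsets-suc n (λ A → 𝟙 (card A ≤? 1) * h A) ⟩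
    (∑[ A ← subsets n ] 𝟙 (card A ≤? 1) * h (outside ∷ A))
    + (∑[ A ← subsets n ] 𝟙 (suc (card A) ≤? 1) * h (inside ∷ A))
      ≡⟨ cong₂ _+_ (∑-card≤1 n (h ∘ (outside ∷_)))
          (trans (∑-cong (subsets n) λ A → cong (_* h (inside ∷ A))
                    (𝟙-cong (suc (card A) ≤? 1) (card A ≤? 0) ℕ.s≤s⁻¹ s≤s))
                 (∑-card≤0 n (h ∘ (inside ∷_)))) ⟩
    h ⊥ + (∑[ x ← allFin n ] h ⁅ suc x ⁆) + h ⁅ zero ⁆
      ≡⟨ lemma (h ⊥) _ _ ⟩
    h ⊥ + (h ⁅ zero ⁆ + (∑[ x ← allFin n ] h ⁅ suc x ⁆))
      ≡⟨ cong (h ⊥ +_) (∑-allFin-suc n (λ x → h ⁅ x ⁆)) ⟨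
    h ⊥ + (∑[ x ← allFin (suc n) ] h ⁅ x ⁆) ∎
    where
    open ≡-Reasoning
    lemma : ∀ a b c → a + b + c ≡ a + (c + b)
    lemma = solve-∀

  Disjoint : ∀ {n} → Subset n → Subset n → Set
  Disjoint B C = ∀ y → y ∈ B → y ∉ C

  disjoint? : ∀ {n} (B C : Subset n) → Dec (Disjoint B C)
  disjoint? B C = all? λ y → (y ∈? B) →-dec ¬? (y ∈? C)

  -- Each point lies in `B` only, in `C` only or in neither: three of the four ways to extend a pair
  -- by one point survive.
  ∑-disjoint : ∀ n → ∑[ B ← subsets n ] ∑[ C ← subsets n ] 𝟙 (disjoint? B C) ≡ 3 ^ n
  ∑-disjoint zero    = refl
  ∑-disjoint (suc n) = begin
    ∑[ B ← subsets (suc n) ] ∑[ C ← subsets (suc n) ] 𝟙 (disjoint? B C)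
      ≡⟨ ∑-subsets-suc n (λ B → ∑[ C ← subsets (suc n) ] 𝟙 (disjoint? B C)) ⟩
    (∑[ B ← subsets n ] ∑[ C ← subsets (suc n) ] 𝟙 (disjoint? (outside ∷ B) C))
    + (∑[ B ← subsets n ] ∑[ C ← subsets (suc n) ] 𝟙 (disjoint? (inside ∷ B) C))
      ≡⟨ cong₂ _+_ (split outside) (split inside) ⟩
    (part outside outside + part outside inside) + (part inside outside + part inside inside)
      ≡⟨ cong₂ _+_ (cong₂ _+_ (same outside outside λ ())
                              (same outside inside λ ()))
                   (cong₂ _+_ (same inside outside λ _ ()) none) ⟩
    (3 ^ n + 3 ^ n) + (3 ^ n + 0)
      ≡⟨ lemma (3 ^ n) ⟩
    3 ^ suc n ∎
    where
    open ≡-Reasoning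
    part : ∀ s t → ℕ
    part s t = ∑[ B ← subsets n ] ∑[ C ← subsets n ] 𝟙 (disjoint? (s ∷ B) (t ∷ C))
    split : ∀ s → ∑[ B ← subsets n ] (∑[ C ← subsets (suc n) ] 𝟙 (disjoint? (s ∷ B) C)) ≡ part s outside + part s inside
    split s = trans (∑-cong (subsets n) λ B → ∑-subsets-suc n (λ C → 𝟙 (disjoint? (s ∷ B) C)))
                    (∑-+ (subsets n) _ _)
    same : ∀ s t → (∀ {B C : Subset n} → zero ∈ (s ∷ B) → zero ∉ (t ∷ C)) → part s t ≡ 3 ^ n
    same s t h = trans (∑-cong (subsets n) λ B → ∑-cong (subsets n) λ C →
      𝟙-cong (disjoint? (s ∷ B) (t ∷ C)) (disjoint? B C)
        (λ D y y∈B y∈C → D (suc y) (there y∈B) (there y∈C))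
        (λ { D zero → h ; D (suc y) y∈B y∈C → D y (drop-there y∈B) (drop-there y∈C) })) (∑-disjoint n)
    none : part inside inside ≡ 0
    none = trans (∑-cong (subsets n) λ B → trans (∑-cong (subsets n) λ C →
      𝟙-no (disjoint? (inside ∷ B) (inside ∷ C)) λ D → D zero here here)
        (∑-zero (subsets n))) (∑-zero (subsets n))
    lemma : ∀ a → (a + a) + (a + 0) ≡ 3 * a
    lemma = solve-∀

  -- Independent triples of conflict graphs

  ∑³ : ∀ d → (Subset d → Subset d → Subset d → ℕ) → ℕ
  ∑³ d f = ∑[ A ← subsets d ] ∑[ B ← subsets d ] ∑[ C ← subsets d ] f A B C

  module _ {d : ℕ} where

    ∑³-mono : ∀ {f g} → (∀ A B C → f A B C ≤ g A B C) → ∑³ d f ≤ ∑³ d g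
    ∑³-mono h = ∑-mono (subsets d) λ A → ∑-mono (subsets d) λ B → ∑-mono (subsets d) λ C → h A B C

    ∑³-cong : ∀ {f g} → (∀ A B C → f A B C ≡ g A B C) → ∑³ d f ≡ ∑³ d g
    ∑³-cong h = ∑-cong (subsets d) λ A → ∑-cong (subsets d) λ B → ∑-cong (subsets d) λ C → h A B C

    ∑³-+ : ∀ f g → ∑³ d (λ A B C → f A B C + g A B C) ≡ ∑³ d f + ∑³ d g
    ∑³-+ f g = trans
      (∑-cong (subsets d) λ A → trans (∑-cong (subsets d) λ B → ∑-+ (subsets d) (f A B) (g A B))
                                      (∑-+ (subsets d) _ _))
      (∑-+ (subsets d) _ _)

    ∑³-rotate : ∀ f → ∑³ d f ≡ ∑³ d (λ B C A → f A B C)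
    ∑³-rotate f = trans (∑-swap (subsets d) (subsets d) _)
      (∑-cong (subsets d) λ B → ∑-swap (subsets d) (subsets d) _)

    ∑³-first : ∀ (f : Subset d → ℕ) (g : Subset d → Subset d → Subset d → ℕ) →
      ∑³ d (λ A B C → f A * g A B C) ≡ ∑[ A ← subsets d ] f A * (∑[ B ← subsets d ] ∑[ C ← subsets d ] g A B C)
    ∑³-first f g = ∑-cong (subsets d) λ A →
      trans (∑-cong (subsets d) λ B → ∑-*ˡ (subsets d) (f A) _) (∑-*ˡ (subsets d) (f A) _)

    ∑³-product : ∀ (f g h : Subset d → ℕ) →
      ∑³ d (λ A B C → f A * (g B * h C)) ≡ ∑ (subsets d) f * (∑ (subsets d) g * ∑ (subsets d) h)
    ∑³-product f g h = trans (∑³-first f (λ _ B C → g B * h C)) (trans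
      (∑-cong (subsets d) λ A → cong (f A *_)
        (trans (∑-cong (subsets d) λ B → ∑-*ˡ (subsets d) (g B) h) (∑-*ʳ (subsets d) (∑ (subsets d) h) g)))
      (∑-*ʳ (subsets d) _ f))

    ∑³-swap : ∀ {A : Set} (xs : List A) (f : Subset d → Subset d → Subset d → A → ℕ) →
      ∑³ d (λ A B C → ∑ xs (f A B C)) ≡ ∑[ x ← xs ] ∑³ d (λ A B C → f A B C x)
    ∑³-swap xs f = trans
      (∑-cong (subsets d) λ A → trans (∑-cong (subsets d) λ B → ∑-swap (subsets d) xs _) (∑-swap (subsets d) xs _))
      (∑-swap (subsets d) xs _)

  Free : ∀ {d} → (Fin d → Fin d → Set) → Subset d → Subset d → Set
  Free E A B = ∀ x y → x ∈ A → y ∈ B → ¬ E x y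

  free? : ∀ {d} {E : Fin d → Fin d → Set} → (∀ x y → Dec (E x y)) → ∀ A B → Dec (Free E A B)
  free? E? A B = all? λ x → all? λ y → (x ∈? A) →-dec (y ∈? B) →-dec ¬? (E? x y)

  free-mono : ∀ {d} {E : Fin d → Fin d → Set} {A A′ B B′ : Subset d} →
              A ⊆ A′ → B ⊆ B′ → Free E A′ B′ → Free E A B
  free-mono A⊆ B⊆ h x y x∈A y∈B = h x y (A⊆ x∈A) (B⊆ y∈B)

  -- The three relations are oriented cyclically, so that one branching lemma and rotations cover
  -- all three sides.
  record Conflict (d : ℕ) : Set₁ where
    constructor conflict
    field
      {E F G} : Fin d → Fin d → Set
      E? : ∀ x y → Dec (E x y)
      F? : ∀ y z → Dec (F y z)
      G? : ∀ z x → Dec (G z x)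

  open Conflict

  rotate : ∀ {d} → Conflict d → Conflict d
  rotate c = conflict (F? c) (G? c) (E? c)

  module _ {d : ℕ} where

    Fits : Conflict d → (X Y Z A B C : Subset d) → Set
    Fits c X Y Z A B C = (A ⊆ X × B ⊆ Y × C ⊆ Z) × (Free (E c) A B × Free (F c) B C × Free (G c) C A)

    fits? : ∀ c X Y Z A B C → Dec (Fits c X Y Z A B C)
    fits? c X Y Z A B C =
      ((A ⊆? X) ×-dec (B ⊆? Y) ×-dec (C ⊆? Z)) ×-dec
      (free? (E? c) A B ×-dec free? (F? c) B C ×-dec free? (G? c) C A)

    count : Conflict d → (X Y Z : Subset d) → ℕ
    count c X Y Z = ∑³ d λ A B C → 𝟙 (fits? c X Y Z A B C)

    count-rotate : ∀ c X Y Z → count c X Y Z ≡ count (rotate c) Y Z X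
    count-rotate c X Y Z = trans (∑³-rotate (λ A B C → 𝟙 (fits? c X Y Z A B C))) (∑³-cong λ B C A →
      𝟙-cong (fits? c X Y Z A B C) (fits? (rotate c) Y Z X B C A)
        (λ { ((a , b , c) , (e , f , g)) → (b , c , a) , (f , g , e) })
        (λ { ((b , c , a) , (f , g , e)) → (a , b , c) , (e , f , g) }))

    count-mono : ∀ c {X X′ Y Y′ Z Z′} → X ⊆ X′ → Y ⊆ Y′ → Z ⊆ Z′ → count c X Y Z ≤ count c X′ Y′ Z′
    count-mono c {X} {X′} {Y} {Y′} {Z} {Z′} X⊆ Y⊆ Z⊆ = ∑³-mono λ A B C →
      𝟙-mono (fits? c X Y Z A B C) (fits? c X′ Y′ Z′ A B C)
        (λ { ((a , b , c) , free) → ((λ x → X⊆ (a x)) , (λ x → Y⊆ (b x)) , (λ x → Z⊆ (c x))) , free })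

    count≤2^ : ∀ c X Y Z → count c X Y Z ≤ 2 ^ (card X + (card Y + card Z))
    count≤2^ c X Y Z = begin
      count c X Y Z
        ≤⟨ ∑³-mono (λ A B C → 𝟙≤ (fits? c X Y Z A B C) λ { ((a , b , c) , _) →
             ℕₚ.≤-reflexive (sym (cong₂ _*_ (𝟙-yes (A ⊆? X) a) (cong₂ _*_ (𝟙-yes (B ⊆? Y) b) (𝟙-yes (C ⊆? Z) c)))) }) ⟩
      ∑³ d (λ A B C → 𝟙 (A ⊆? X) * (𝟙 (B ⊆? Y) * 𝟙 (C ⊆? Z)))
        ≡⟨ trans (∑³-product (λ A → 𝟙 (A ⊆? X)) (λ B → 𝟙 (B ⊆? Y)) (λ C → 𝟙 (C ⊆? Z)))
             (cong₂ _*_ (∑-⊆ X) (cong₂ _*_ (∑-⊆ Y) (∑-⊆ Z))) ⟩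
      2 ^ card X * (2 ^ card Y * 2 ^ card Z)
        ≡⟨ trans (ℕₚ.^-distribˡ-+-* 2 (card X) _) (cong (2 ^ card X *_) (ℕₚ.^-distribˡ-+-* 2 (card Y) _)) ⟨
      2 ^ (card X + (card Y + card Z)) ∎
      where open ℕₚ.≤-Reasoning

    avoid : {E : Fin d → Fin d → Set} (E? : ∀ x y → Dec (E x y)) (x : Fin d) → Subset d → Subset d
    avoid E? x Y = ⟦ (λ y → (y ∈? Y) ×-dec ¬? (E? x y)) ⟧

    -- Either `x ∉ A`, or `x ∈ A` and then `B` contains no neighbour of `x`. In the second case `x`
    -- is erased from `A`, since the restriction of `Y` records its effect on `B`; thus `X` shrinks
    -- in both branches.
    count-branch : ∀ c X Y Z x → count c X Y Z ≤ count c (X - x) Y Z + count c (X - x) (avoid (E? c) x Y) Z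
    count-branch c X Y Z x = ℕₚ.≤-trans
      (∑-fibre x f (λ A → g₁ A + g₂ A) λ A → ℕₚ.+-mono-≤ (step₁ A) (step₂ A))
      (ℕₚ.≤-reflexive (∑-+ (subsets d) g₁ g₂))
      where
      Y′ : Subset d
      Y′ = avoid (E? c) x Y
      f g₁ g₂ : Subset d → ℕ
      f  A = ∑[ B ← subsets d ] ∑[ C ← subsets d ] 𝟙 (fits? c X Y Z A B C)
      g₁ A = ∑[ B ← subsets d ] ∑[ C ← subsets d ] 𝟙 (fits? c (X - x) Y Z A B C)
      g₂ A = ∑[ B ← subsets d ] ∑[ C ← subsets d ] 𝟙 (fits? c (X - x) Y′ Z A B C)

      x∈in : (A : Subset d) → x ∈ A [ x ]≔ inside
      x∈in A = []≔-updates A x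

      x∉out : (A : Subset d) {y : Fin d} → y ∈ A [ x ]≔ outside → y ≢ x
      x∉out A y∈ refl = contradiction ([]=-injective y∈ ([]≔-updates A x)) λ ()

      out⊆in : (A : Subset d) → A [ x ]≔ outside ⊆ A [ x ]≔ inside
      out⊆in A {y} y∈ = subst (y ∈_) ([]≔-idempotent A x)
        ([]≔-minimal (A [ x ]≔ outside) y x (x∉out A y∈) y∈)

      step₁ : ∀ A → f (A [ x ]≔ outside) ≤ g₁ (A [ x ]≔ outside)
      step₁ A = ∑-mono (subsets d) λ B → ∑-mono (subsets d) λ C →
        𝟙-mono (fits? c X Y Z (A [ x ]≔ outside) B C) (fits? c (X - x) Y Z (A [ x ]≔ outside) B C)
          λ { ((A⊆ , rest) , free) → ((λ y∈ → x∈p∧x≢y⇒x∈p-y (A⊆ y∈) (x∉out A y∈)) , rest) , free }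

      step₂ : ∀ A → f (A [ x ]≔ inside) ≤ g₂ (A [ x ]≔ outside)
      step₂ A = ∑-mono (subsets d) λ B → ∑-mono (subsets d) λ C →
        𝟙-mono (fits? c X Y Z (A [ x ]≔ inside) B C) (fits? c (X - x) Y′ Z (A [ x ]≔ outside) B C)
          λ { ((A⊆ , B⊆ , C⊆) , (e , f , g)) →
            ( (λ y∈ → x∈p∧x≢y⇒x∈p-y (A⊆ (out⊆in A y∈)) (x∉out A y∈))
            , (λ {y} y∈ → ∈⟦⟧⁺ (λ y → (y ∈? Y) ×-dec ¬? (E? c x y)) (B⊆ y∈ , e x y (x∈in A) y∈))
            , C⊆)
            , (free-mono {E = E c} (out⊆in A) id e , f , free-mono {E = G c} id (out⊆in A) g) }

    count-delete : ∀ c X Y Z x → count c X Y Z ≤ 2 * count c (X - x) Y Z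
    count-delete c X Y Z x = begin
      count c X Y Z
        ≤⟨ count-branch c X Y Z x ⟩
      count c (X - x) Y Z + count c (X - x) (avoid (E? c) x Y) Z
        ≤⟨ ℕₚ.+-monoʳ-≤ (count c (X - x) Y Z) (count-mono c id (λ y∈ → proj₁ (∈⟦⟧⁻ (λ y → (y ∈? Y) ×-dec ¬? (E? c x y)) y∈)) id) ⟩
      count c (X - x) Y Z + count c (X - x) Y Z
        ≡⟨ cong (count c (X - x) Y Z +_) (ℕₚ.+-identityʳ _) ⟨
      2 * count c (X - x) Y Z ∎
      where open ℕₚ.≤-Reasoning

  -- Inequalities between powers

  ^-distribʳ-* : ∀ m n o → (m * n) ^ o ≡ m ^ o * n ^ o
  ^-distribʳ-* m n zero    = refl
  ^-distribʳ-* m n (suc o) rewrite ^-distribʳ-* m n o = lemma m n (m ^ o) (n ^ o)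
    where
    lemma : ∀ a b c d → a * b * (c * d) ≡ a * c * (b * d)
    lemma = solve-∀

  ^-swap : ∀ m n o → (m ^ n) ^ o ≡ (m ^ o) ^ n
  ^-swap m n o = trans (ℕₚ.^-*-assoc m n o) (trans (cong (m ^_) (ℕₚ.*-comm n o)) (sym (ℕₚ.^-*-assoc m o n)))

  ^-cancelˡ-≤ : ∀ e .{{_ : NonZero e}} {m n} → m ^ e ≤ n ^ e → m ≤ n
  ^-cancelˡ-≤ e m^e≤n^e = ℕₚ.≮⇒≥ λ n<m → ℕₚ.<⇒≱ (ℕₚ.^-monoˡ-< e n<m) m^e≤n^e

  module _ {S : Set} (i μ : S → ℕ) (M s m : ℕ) (ratio : m ^ suc s ≤ suc m ^ s)
           (branch : ∀ U → i U ≤ M ⊎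
                     ∃₂ λ U₁ U₂ → i U ≤ i U₁ + i U₂ × μ U₁ < μ U × μ U₂ + s < μ U) where

    -- By hypothesis λ = 1 + 1/m satisfies λ^(n-1) + λ^(n-1-s) ≤ λ^n, so i U ≤ λ^(μ U) M.
    branching : ∀ n U → μ U ≤ n → i U * m ^ n ≤ suc m ^ n * M
    branching n = go n n ℕₚ.≤-refl
      where
      open ℕₚ.≤-Reasoning
      -- Induction on a bound `b` for `n`: the second branch jumps down to `n ∸ s` instead of the
      -- predecessor.
      go : ∀ b n → n ≤ b → ∀ U → μ U ≤ n → i U * m ^ n ≤ suc m ^ n * M
      go b n n≤b U μ≤n with branch U
      ... | inj₁ i≤M = begin
        i U * m ^ n       ≤⟨ ℕₚ.*-mono-≤ i≤M (ℕₚ.^-monoˡ-≤ n (ℕₚ.n≤1+n m)) ⟩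
        M * suc m ^ n     ≡⟨ ℕₚ.*-comm M _ ⟩
        suc m ^ n * M     ∎
      go b zero n≤b U μ≤n | inj₂ (_ , _ , _ , μ₁< , _) = contradiction (ℕₚ.<-≤-trans μ₁< μ≤n) λ ()
      go (suc b) (suc n) (s≤s n≤b) U μ≤n | inj₂ (U₁ , U₂ , i≤ , μ₁< , μ₂<) = begin
        i U * (m * m ^ n)
          ≤⟨ ℕₚ.*-monoˡ-≤ (m * m ^ n) i≤ ⟩
        (i U₁ + i U₂) * (m * m ^ n)
          ≡⟨ cong (λ x → (i U₁ + i U₂) * (m * x)) m^n ⟩
        (i U₁ + i U₂) * (m * (m ^ k * m ^ s))
          ≡⟨ lemma₁ (i U₁) (i U₂) m (m ^ k) (m ^ s) ⟩
        m * (i U₁ * (m ^ k * m ^ s)) + (i U₂ * m ^ k) * m ^ suc s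
          ≡⟨ cong (λ x → m * (i U₁ * x) + (i U₂ * m ^ k) * m ^ suc s) m^n ⟨
        m * (i U₁ * m ^ n) + (i U₂ * m ^ k) * m ^ suc s
          ≤⟨ ℕₚ.+-mono-≤ (ℕₚ.*-monoʳ-≤ m (go b n n≤b U₁ (ℕ.s≤s⁻¹ (ℕₚ.<-≤-trans μ₁< μ≤n))))
               (ℕₚ.*-mono-≤ (go b k (ℕₚ.≤-trans (ℕₚ.m∸n≤m n s) n≤b) U₂
                  (ℕₚ.m+n≤o⇒m≤o∸n _ μ₂+s≤n)) ratio) ⟩
        m * (suc m ^ n * M) + (suc m ^ k * M) * suc m ^ s
          ≡⟨ lemma₂ m (suc m ^ n) M (suc m ^ k) (suc m ^ s) ⟩
        (m * suc m ^ n + suc m ^ k * suc m ^ s) * M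
          ≡⟨ cong (λ x → (m * suc m ^ n + x) * M)
               (trans (sym (ℕₚ.^-distribˡ-+-* (suc m) k s)) (cong (suc m ^_) (ℕₚ.m∸n+n≡m s≤n))) ⟩
        (m * suc m ^ n + suc m ^ n) * M
          ≡⟨ cong (_* M) (ℕₚ.+-comm (m * suc m ^ n) _) ⟩
        suc m ^ suc n * M ∎
        where
        k : ℕ
        k = n ∸ s
        μ₂+s≤n : μ U₂ + s ≤ n
        μ₂+s≤n = ℕ.s≤s⁻¹ (ℕₚ.<-≤-trans μ₂< μ≤n)
        s≤n : s ≤ n
        s≤n = ℕₚ.≤-trans (ℕₚ.m≤n+m s (μ U₂)) μ₂+s≤n
        m^n : m ^ n ≡ m ^ k * m ^ s
        m^n = trans (cong (m ^_) (sym (ℕₚ.m∸n+n≡m s≤n))) (ℕₚ.^-distribˡ-+-* m k s)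
        lemma₁ : ∀ a b m x y → (a + b) * (m * (x * y)) ≡ m * (a * (x * y)) + (b * x) * (m * y)
        lemma₁ = solve-∀
        lemma₂ : ∀ m x M y z → m * (x * M) + (y * M) * z ≡ (m * x + y * z) * M
        lemma₂ = solve-∀

  -- Bernoulli's inequality `1 + d/n ≤ (1 + 1/n)^d` with denominators cleared.
  bernoulli-up : ∀ n d → (n + d) * n ^ d ≤ n * suc n ^ d
  bernoulli-up n zero    = ℕₚ.≤-reflexive (cong (_* 1) (ℕₚ.+-identityʳ n))
  bernoulli-up n (suc d) = begin
    (n + suc d) * (n * n ^ d)
      ≤⟨ ℕₚ.m≤m+n _ (d * n ^ d) ⟩
    (n + suc d) * (n * n ^ d) + d * n ^ d
      ≡⟨ lemma₁ n d (n ^ d) ⟩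
    (n + d) * n ^ d * suc n
      ≤⟨ ℕₚ.*-monoˡ-≤ (suc n) (bernoulli-up n d) ⟩
    n * suc n ^ d * suc n
      ≡⟨ lemma₂ n (suc n ^ d) ⟩
    n * (suc n * suc n ^ d) ∎
    where
    open ℕₚ.≤-Reasoning
    lemma₁ : ∀ n d x → (n + (1 + d)) * (n * x) + d * x ≡ (n + d) * x * (1 + n)
    lemma₁ = solve-∀
    lemma₂ : ∀ n x → n * x * (1 + n) ≡ n * ((1 + n) * x)
    lemma₂ = solve-∀

  -- Bernoulli's inequality `(1 - 1/(n+1))^e ≥ 1 - e/(n+1)`, multiplied by `(n+1)^(e+1)` and
  -- rearranged so that nothing is subtracted.
  bernoulli-down : ∀ n e → suc n ^ suc e ≤ n ^ e * suc n + e * suc n ^ e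
  bernoulli-down n zero    = ℕₚ.≤-reflexive (lemma n)
    where
    lemma : ∀ n → (1 + n) * 1 ≡ 1 * (1 + n) + 0 * 1
    lemma = solve-∀
  bernoulli-down n (suc e) = begin
    suc n * suc n ^ suc e
      ≤⟨ ℕₚ.*-monoʳ-≤ (suc n) (bernoulli-down n e) ⟩
    suc n * (n ^ e * suc n + e * suc n ^ e)
      ≡⟨ lemma₁ n (n ^ e) e (suc n ^ e) ⟩
    n * n ^ e * suc n + (n ^ e * suc n + e * (suc n * suc n ^ e))
      ≤⟨ ℕₚ.+-monoʳ-≤ (n * n ^ e * suc n) (ℕₚ.+-monoˡ-≤ _
          (ℕₚ.≤-trans (ℕₚ.*-monoˡ-≤ (suc n) (ℕₚ.^-monoˡ-≤ e (ℕₚ.n≤1+n n))) (ℕₚ.≤-reflexive (ℕₚ.*-comm _ (suc n))))) ⟩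
    n * n ^ e * suc n + suc e * suc n ^ suc e ∎
    where
    open ℕₚ.≤-Reasoning
    lemma₁ : ∀ n x e y → (1 + n) * (x * (1 + n) + e * y) ≡ n * x * (1 + n) + (x * (1 + n) + e * ((1 + n) * y))
    lemma₁ = solve-∀

  -- Since `d + 1 ≤ n (1 + 1/n)^d`, the left side is at most `n^e ((1 + 1/n)^e p)^d`. A large `n`
  -- brings the base down to `p′`, and the constant is `n^e`.
  poly≤exp : ∀ e {p p′} → p < p′ → ∃ λ K → ∀ d → suc d ^ e * p ^ d ≤ K * p′ ^ d
  poly≤exp e {p} {suc r} (s≤s p≤r) = n ^ e , bound
    where
    open ℕₚ.≤-Reasoning
    -- By Bernoulli (1 - 1/(n+1))^e ≥ 1 - e/(n+1) > 1 - 1/p′ ≥ p/p′.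
    n : ℕ
    n = suc e * suc r
    step : suc n ^ e * p ≤ n ^ e * suc r
    step = ℕₚ.≤-trans (ℕₚ.*-monoʳ-≤ (suc n ^ e) p≤r)
      (ℕₚ.*-cancelˡ-≤ (suc n) (ℕₚ.+-cancelʳ-≤ (suc n * suc n ^ e) _ _ (begin
        suc n * (suc n ^ e * r) + suc n * suc n ^ e
          ≡⟨ lemma₁ n (suc n ^ e) r ⟩
        suc r * (suc n * suc n ^ e)
          ≤⟨ ℕₚ.*-monoʳ-≤ (suc r) (bernoulli-down n e) ⟩
        suc r * (n ^ e * suc n + e * suc n ^ e)
          ≡⟨ lemma₂ r (n ^ e) n e (suc n ^ e) ⟩
        suc n * (n ^ e * suc r) + e * suc r * suc n ^ e
          ≤⟨ ℕₚ.+-monoʳ-≤ (suc n * (n ^ e * suc r)) (ℕₚ.*-monoˡ-≤ (suc n ^ e)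
               (ℕₚ.≤-trans (ℕₚ.*-monoˡ-≤ (suc r) (ℕₚ.n≤1+n e)) (ℕₚ.n≤1+n n))) ⟩
        suc n * (n ^ e * suc r) + suc n * suc n ^ e ∎)))
      where
      lemma₁ : ∀ n x r → (1 + n) * (x * r) + (1 + n) * x ≡ (1 + r) * ((1 + n) * x)
      lemma₁ = solve-∀
      lemma₂ : ∀ r x n e y → (1 + r) * (x * (1 + n) + e * y) ≡ (1 + n) * (x * (1 + r)) + e * (1 + r) * y
      lemma₂ = solve-∀
    instance
      _ : NonZero (n ^ e)
      _ = ℕₚ.m^n≢0 n e
    bound : ∀ d → suc d ^ e * p ^ d ≤ n ^ e * suc r ^ d
    bound d = ℕₚ.*-cancelʳ-≤ _ _ ((n ^ e) ^ d) {{ℕₚ.m^n≢0 (n ^ e) d}} (begin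
      suc d ^ e * p ^ d * (n ^ e) ^ d
        ≡⟨ cong (suc d ^ e * p ^ d *_) (^-swap n e d) ⟩
      suc d ^ e * p ^ d * (n ^ d) ^ e
        ≡⟨ lemma₁ (suc d ^ e) (p ^ d) ((n ^ d) ^ e) ⟩
      suc d ^ e * (n ^ d) ^ e * p ^ d
        ≡⟨ cong (_* p ^ d) (^-distribʳ-* (suc d) (n ^ d) e) ⟨
      (suc d * n ^ d) ^ e * p ^ d
        ≤⟨ ℕₚ.*-monoˡ-≤ (p ^ d) (ℕₚ.^-monoˡ-≤ e (ℕₚ.≤-trans
             (ℕₚ.*-monoˡ-≤ (n ^ d) (s≤s (ℕₚ.m≤n+m d (r + e * suc r)))) (bernoulli-up n d))) ⟩
      (n * suc n ^ d) ^ e * p ^ d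
        ≡⟨ cong (_* p ^ d) (trans (^-distribʳ-* n (suc n ^ d) e) (cong (n ^ e *_) (^-swap (suc n) d e))) ⟩
      n ^ e * (suc n ^ e) ^ d * p ^ d
        ≡⟨ trans (ℕₚ.*-assoc (n ^ e) _ _) (cong (n ^ e *_) (sym (^-distribʳ-* (suc n ^ e) p d))) ⟩
      n ^ e * (suc n ^ e * p) ^ d
        ≤⟨ ℕₚ.*-monoʳ-≤ (n ^ e) (ℕₚ.^-monoˡ-≤ d step) ⟩
      n ^ e * (n ^ e * suc r) ^ d
        ≡⟨ cong (n ^ e *_) (^-distribʳ-* (n ^ e) (suc r) d) ⟩
      n ^ e * ((n ^ e) ^ d * suc r ^ d)
        ≡⟨ lemma₂ (n ^ e) ((n ^ e) ^ d) (suc r ^ d) ⟩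
      n ^ e * suc r ^ d * (n ^ e) ^ d ∎)
      where
      lemma₁ : ∀ a b c → a * b * c ≡ a * c * b
      lemma₁ = solve-∀
      lemma₂ : ∀ a b c → a * (b * c) ≡ a * c * b
      lemma₂ = solve-∀

  -- The hypothesis says that the `N`-th root of `2^c` is at most `b/a`. Comparing `N`-th powers
  -- keeps roots and fractional exponents out.
  root-bound : ∀ N .{{_ : NonZero N}} {a b c} → 2 ^ c * a ^ N ≤ b ^ N →
               ∀ d u → N * u ≤ c * d → 2 ^ u * a ^ d ≤ b ^ d
  root-bound N {a} {b} {c} h d u Nu≤cd = ^-cancelˡ-≤ N (begin
    (2 ^ u * a ^ d) ^ N
      ≡⟨ trans (^-distribʳ-* (2 ^ u) (a ^ d) N)
          (cong₂ _*_ (trans (ℕₚ.^-*-assoc 2 u N) (cong (2 ^_) (ℕₚ.*-comm u N))) (^-swap a d N)) ⟩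
    2 ^ (N * u) * (a ^ N) ^ d
      ≤⟨ ℕₚ.*-monoˡ-≤ ((a ^ N) ^ d) (ℕₚ.^-monoʳ-≤ 2 Nu≤cd) ⟩
    2 ^ (c * d) * (a ^ N) ^ d
      ≡⟨ trans (^-distribʳ-* (2 ^ c) (a ^ N) d) (cong (_* (a ^ N) ^ d) (ℕₚ.^-*-assoc 2 c d)) ⟨
    (2 ^ c * a ^ N) ^ d
      ≤⟨ ℕₚ.^-monoˡ-≤ d h ⟩
    (b ^ N) ^ d
      ≡⟨ ^-swap b N d ⟩
    (b ^ d) ^ N ∎)
    where open ℕₚ.≤-Reasoning

  -- Since r ≤ 2j, the worst case is r = 2j, with base 72^(1/4) < 147/50.
  pairs-bound : ∀ d j r → j + (j + r) ≡ d → r + r ≤ d → 8 ^ j * 3 ^ r * 50 ^ d ≤ 147 ^ d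
  pairs-bound d j r eq r+r≤d = ^-cancelˡ-≤ 2 (begin
    (8 ^ j * 3 ^ r * 50 ^ d) ^ 2
      ≡⟨ trans (^-distribʳ-* (8 ^ j * 3 ^ r) (50 ^ d) 2)
           (cong₂ _*_ (trans (^-distribʳ-* (8 ^ j) (3 ^ r) 2)
             (cong₂ _*_ (trans (ℕₚ.^-*-assoc 8 j 2) (cong (8 ^_) 2j)) (^-swap 3 r 2)))
             (trans (^-swap 50 d 2) (cong (2500 ^_) d≡))) ⟩
    8 ^ (r + s) * 9 ^ r * 2500 ^ (r + s + r)
      ≡⟨ cong₂ (λ x y → x * 9 ^ r * y) (ℕₚ.^-distribˡ-+-* 8 r s)
           (trans (ℕₚ.^-distribˡ-+-* 2500 (r + s) r) (cong (_* 2500 ^ r) (ℕₚ.^-distribˡ-+-* 2500 r s))) ⟩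
    8 ^ r * 8 ^ s * 9 ^ r * (2500 ^ r * 2500 ^ s * 2500 ^ r)
      ≡⟨ lemma (8 ^ r) (8 ^ s) (9 ^ r) (2500 ^ r) (2500 ^ s) ⟩
    8 ^ r * 9 ^ r * (2500 ^ r * 2500 ^ r) * (8 ^ s * 2500 ^ s)
      ≡⟨ cong₂ _*_ (trans (^-distribʳ-* 72 6250000 r)
           (cong₂ _*_ (^-distribʳ-* 8 9 r) (^-distribʳ-* 2500 2500 r))) (^-distribʳ-* 8 2500 s) ⟨
    450000000 ^ r * 20000 ^ s
      -- These are `72 * 50^4 ≤ 147^4` for the `r` factors and `8 * 50^2 ≤ 147^2` for the `s`
      -- factors, where `s` is the excess of `2j` over `r`.
      ≤⟨ ℕₚ.*-mono-≤ (ℕₚ.^-monoˡ-≤ r (ℕₚ.≤ᵇ⇒≤ 450000000 466948881 _)) (ℕₚ.^-monoˡ-≤ s (ℕₚ.≤ᵇ⇒≤ 20000 21609 _)) ⟩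
    466948881 ^ r * 21609 ^ s
      ≡⟨ cong (_* 21609 ^ s) (^-distribʳ-* 21609 21609 r) ⟩
    21609 ^ r * 21609 ^ r * 21609 ^ s
      ≡⟨ lemma₂ (21609 ^ r) (21609 ^ s) ⟩
    21609 ^ r * 21609 ^ s * 21609 ^ r
      ≡⟨ trans (ℕₚ.^-distribˡ-+-* 21609 (r + s) r) (cong (_* 21609 ^ r) (ℕₚ.^-distribˡ-+-* 21609 r s)) ⟨
    21609 ^ (r + s + r)
      ≡⟨ cong (21609 ^_) d≡ ⟨
    21609 ^ d
      ≡⟨ ^-swap 147 2 d ⟩
    (147 ^ d) ^ 2 ∎)
    where
    open ℕₚ.≤-Reasoning
    r≤j+j : r ≤ j + j
    r≤j+j = ℕₚ.+-cancelʳ-≤ r r (j + j) (ℕₚ.≤-trans r+r≤d (ℕₚ.≤-reflexive (trans (sym eq) (sym (ℕₚ.+-assoc j j r)))))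
    s : ℕ
    s = j + j ∸ r
    r+s : r + s ≡ j + j
    r+s = ℕₚ.m+[n∸m]≡n r≤j+j
    2j : j * 2 ≡ r + s
    2j = trans (lemma₁ j) (sym r+s)
      where
      lemma₁ : ∀ j → j * 2 ≡ j + j
      lemma₁ = solve-∀
    d≡ : d ≡ r + s + r
    d≡ = trans (sym eq) (trans (sym (ℕₚ.+-assoc j j r)) (cong (_+ r) (sym r+s)))
    lemma : ∀ a b c x y → a * b * c * (x * y * x) ≡ a * c * (x * x) * (b * y)
    lemma = solve-∀
    lemma₂ : ∀ x y → x * x * y ≡ x * y * x
    lemma₂ = solve-∀

  -- Latin squares

  -- A ternary relation treats the three coordinates alike. The arguments of `first`, `second` and
  -- `third` follow the cyclic order, so a rotation only permutes the fields.
  record Latin (d : ℕ) : Set₁ where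
    field
      R  : Fin d → Fin d → Fin d → Set
      R? : ∀ x y z → Dec (R x y z)
      first second third : Fin d → Fin d → Fin d
      R-first  : ∀ y z → R (first y z) y z
      R-second : ∀ z x → R x (second z x) z
      R-third  : ∀ x y → R x y (third x y)
      first-unique  : ∀ {x y z} → R x y z → x ≡ first y z
      second-unique : ∀ {x y z} → R x y z → y ≡ second z x
      third-unique  : ∀ {x y z} → R x y z → z ≡ third x y

  open Latin

  rotateᴸ : ∀ {d} → Latin d → Latin d
  rotateᴸ L = record
    { R = λ y z x → R L x y z ; R? = λ y z x → R? L x y z
    ; first = second L ; second = third L ; third = first L
    ; R-first = R-second L ; R-second = R-third L ; R-third = R-first L
    ; first-unique = second-unique L ; second-unique = third-unique L ; third-unique = first-unique L
    }

  module _ {d : ℕ} {E : Fin d → Fin d → Set} (E? : ∀ x y → Dec (E x y)) where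

    degree : Fin d → Subset d → ℕ
    degree x Y = ∑[ y ← allFin d ] 𝟙 ((y ∈? Y) ×-dec E? x y)

    heavy? : ∀ s X Y → Dec (∃ λ x → x ∈ X × s ≤ degree x Y)
    heavy? s X Y = any? λ x → (x ∈? X) ×-dec (s ≤? degree x Y)

    card-avoid : ∀ x Y → card (avoid E? x Y) + degree x Y ≡ card Y
    card-avoid x Y = begin
      card (avoid E? x Y) + degree x Y
        ≡⟨ cong (_+ degree x Y) (card-⟦⟧ (λ y → (y ∈? Y) ×-dec ¬? (E? x y))) ⟩
      (∑[ y ← allFin d ] 𝟙 ((y ∈? Y) ×-dec ¬? (E? x y))) + degree x Y
        ≡⟨ ∑-+ (allFin d) _ _ ⟨
      ∑[ y ← allFin d ] (𝟙 ((y ∈? Y) ×-dec ¬? (E? x y)) + 𝟙 ((y ∈? Y) ×-dec E? x y))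
        ≡⟨ ∑-cong (allFin d) (λ y → go (y ∈? Y) (E? x y)) ⟩
      ∑[ y ← allFin d ] 𝟙 (y ∈? Y)
        ≡⟨ card-∑ Y ⟩
      card Y ∎
      where
      open ≡-Reasoning
      go : ∀ {P Q : Set} (p : Dec P) (q : Dec Q) → 𝟙 (p ×-dec ¬? q) + 𝟙 (p ×-dec q) ≡ 𝟙 p
      go (yes _) (yes _) = refl
      go (yes _) (no _)  = refl
      go (no _)  q       = refl

    -- Double counting of the edges from `X` to the complement of `Y`: each `x ∈ X` sends at least
    -- `k - s` of them, and each of the `d - card Y` points outside `Y` receives at most `k`. The
    -- inequality is rearranged to avoid subtraction.
    degree-sum : ∀ {k s} → (∀ x → ∑[ y ← allFin d ] 𝟙 (E? x y) ≡ k) →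
                 (∀ y → ∑[ x ← allFin d ] 𝟙 (E? x y) ≡ k) →
                 ∀ X Y → (∀ x → x ∈ X → degree x Y ≤ s) →
                 card X * k + card Y * k ≤ card X * s + d * k
    degree-sum {k} {s} row col X Y light = begin
      card X * k + card Y * k
        ≡⟨ cong₂ _+_ (weight X k) (weight Y k) ⟩
      (∑[ x ← allFin d ] 𝟙 (x ∈? X) * k) + (∑[ y ← allFin d ] 𝟙 (y ∈? Y) * k)
        ≤⟨ ℕₚ.+-monoˡ-≤ _ (∑-mono (allFin d) bound) ⟩
      (∑[ x ← allFin d ] (𝟙 (x ∈? X) * s + outdegree x)) + (∑[ y ← allFin d ] 𝟙 (y ∈? Y) * k)
        ≡⟨ cong (_+ (∑[ y ← allFin d ] 𝟙 (y ∈? Y) * k)) (∑-+ (allFin d) _ _) ⟩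
      (∑[ x ← allFin d ] 𝟙 (x ∈? X) * s) + ∑ (allFin d) outdegree + (∑[ y ← allFin d ] 𝟙 (y ∈? Y) * k)
        ≡⟨ cong (λ e → (∑[ x ← allFin d ] 𝟙 (x ∈? X) * s) + e + (∑[ y ← allFin d ] 𝟙 (y ∈? Y) * k)) total ⟩
      (∑[ x ← allFin d ] 𝟙 (x ∈? X) * s) + (∑[ y ← allFin d ] 𝟙 (¬? (y ∈? Y)) * k) + (∑[ y ← allFin d ] 𝟙 (y ∈? Y) * k)
        ≡⟨ trans (ℕₚ.+-assoc (∑[ x ← allFin d ] 𝟙 (x ∈? X) * s) _ _) (cong₂ _+_ (sym (weight X s)) rest) ⟩
      card X * s + d * k ∎
      where
      open ℕₚ.≤-Reasoning
      outdegree : Fin d → ℕ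
      outdegree x = ∑[ y ← allFin d ] 𝟙 (¬? (y ∈? Y)) * 𝟙 (E? x y)
      weight : ∀ A c → card A * c ≡ ∑[ x ← allFin d ] 𝟙 (x ∈? A) * c
      weight A c = trans (cong (_* c) (sym (card-∑ A))) (sym (∑-*ʳ (allFin d) c _))
      k≡ : ∀ x → degree x Y + outdegree x ≡ k
      k≡ x = trans (sym (∑-+ (allFin d) _ _)) (trans (∑-cong (allFin d) λ y → go (y ∈? Y) (E? x y)) (row x))
        where
        go : ∀ {P Q : Set} (p : Dec P) (q : Dec Q) → 𝟙 (p ×-dec q) + 𝟙 (¬? p) * 𝟙 q ≡ 𝟙 q
        go (yes _) q = ℕₚ.+-identityʳ _
        go (no _)  q = ℕₚ.+-identityʳ _
      bound : ∀ x → 𝟙 (x ∈? X) * k ≤ 𝟙 (x ∈? X) * s + outdegree x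
      bound x with x ∈? X
      ... | no _    = z≤n
      ... | yes x∈X = begin
        k + 0                      ≡⟨ trans (ℕₚ.+-identityʳ k) (sym (k≡ x)) ⟩
        degree x Y + outdegree x   ≤⟨ ℕₚ.+-monoˡ-≤ (outdegree x) (light x x∈X) ⟩
        s + outdegree x            ≡⟨ cong (_+ outdegree x) (ℕₚ.+-identityʳ s) ⟨
        s + 0 + outdegree x        ∎
      total : ∑ (allFin d) outdegree ≡ ∑[ y ← allFin d ] 𝟙 (¬? (y ∈? Y)) * k
      total = trans (∑-swap (allFin d) (allFin d) _) (∑-cong (allFin d) λ y →
        trans (∑-*ˡ (allFin d) (𝟙 (¬? (y ∈? Y))) _) (cong (𝟙 (¬? (y ∈? Y)) *_) (col y)))
      rest : (∑[ y ← allFin d ] 𝟙 (¬? (y ∈? Y)) * k) + (∑[ y ← allFin d ] 𝟙 (y ∈? Y) * k) ≡ d * k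
      rest = trans (sym (∑-+ (allFin d) _ _)) (trans (∑-cong (allFin d) λ y →
          trans (sym (ℕₚ.*-distribʳ-+ k (𝟙 (¬? (y ∈? Y))) _)) (cong (_* k)
            (trans (ℕₚ.+-comm (𝟙 (¬? (y ∈? Y))) _) (𝟙-¬ (y ∈? Y)))))
        (trans (∑-*ʳ (allFin d) k (λ _ → 1)) (cong (_* k) (∑-allFin-1 d))))

  State : ℕ → Set
  State d = Subset d × Subset d × Subset d

  module _ {d : ℕ} where

    size : State d → ℕ
    size (X , Y , Z) = card X + (card Y + card Z)

    countˢ : Conflict d → State d → ℕ
    countˢ c (X , Y , Z) = count c X Y Z

    Split : Conflict d → ℕ → State d → Set
    Split c s U = ∃₂ λ U₁ U₂ →
      countˢ c U ≤ countˢ c U₁ + countˢ c U₂ × size U₁ < size U × size U₂ + s < size U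

    -- The second branch loses at least `s` neighbours from `Y` and also `x` itself, whence the
    -- strict inequality.
    split-heavy : ∀ c s X Y Z → (∃ λ x → x ∈ X × s ≤ degree (E? c) x Y) → Split c s (X , Y , Z)
    split-heavy c s X Y Z (x , x∈X , s≤) =
      (X - x , Y , Z) , (X - x , avoid (E? c) x Y , Z) , count-branch c X Y Z x ,
      ℕₚ.+-monoˡ-< (card Y + card Z) (x∈p⇒∣p-x∣<∣p∣ x∈X) , (begin-strict
        card (X - x) + (card (avoid (E? c) x Y) + card Z) + s
          ≤⟨ ℕₚ.+-monoʳ-≤ (card (X - x) + (card (avoid (E? c) x Y) + card Z)) s≤ ⟩
        card (X - x) + (card (avoid (E? c) x Y) + card Z) + degree (E? c) x Y
          ≡⟨ lemma (card (X - x)) _ (card Z) _ ⟩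
        card (X - x) + (card (avoid (E? c) x Y) + degree (E? c) x Y + card Z)
          ≡⟨ cong (λ a → card (X - x) + (a + card Z)) (card-avoid (E? c) x Y) ⟩
        card (X - x) + (card Y + card Z)
          <⟨ ℕₚ.+-monoˡ-< (card Y + card Z) (x∈p⇒∣p-x∣<∣p∣ x∈X) ⟩
        card X + (card Y + card Z) ∎)
      where
      open ℕₚ.≤-Reasoning
      lemma : ∀ a b c e → a + (b + c) + e ≡ a + (b + e + c)
      lemma = solve-∀

    split-rotate : ∀ c s X Y Z → Split (rotate c) s (Y , Z , X) → Split c s (X , Y , Z)
    split-rotate c s X Y Z ((Y₁ , Z₁ , X₁) , (Y₂ , Z₂ , X₂) , i≤ , <₁ , <₂) =
      (X₁ , Y₁ , Z₁) , (X₂ , Y₂ , Z₂) ,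
      subst₂ _≤_ (sym (count-rotate c X Y Z))
        (sym (cong₂ _+_ (count-rotate c X₁ Y₁ Z₁) (count-rotate c X₂ Y₂ Z₂))) i≤ ,
      subst₂ _<_ (turn X₁ Y₁ Z₁) (turn X Y Z) <₁ ,
      subst₂ _<_ (cong (_+ s) (turn X₂ Y₂ Z₂)) (turn X Y Z) <₂
      where
      turn : ∀ X Y Z → card Y + (card Z + card X) ≡ card X + (card Y + card Z)
      turn X Y Z = lemma (card X) (card Y) (card Z)
        where
        lemma : ∀ a b c → b + (c + a) ≡ a + (b + c)
        lemma = solve-∀

  -- A triple without R-related entries whose i-th part contains Tᵢ is independent in this graph.
  graph : ∀ {d} → Latin d → (T₁ T₂ T₃ : Subset d) → Conflict d
  graph L T₁ T₂ T₃ = conflict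
    (λ x y → any? λ t → (t ∈? T₃) ×-dec R? L x y t)
    (λ y z → any? λ t → (t ∈? T₁) ×-dec R? L t y z)
    (λ z x → any? λ t → (t ∈? T₂) ×-dec R? L x t z)

  module _ {d : ℕ} (L : Latin d) (T₁ T₂ T₃ : Subset d) where

    private
      E?′ : ∀ x y → Dec _
      E?′ = E? (graph L T₁ T₂ T₃)
      third∈ : ∀ x y → 𝟙 (E?′ x y) ≡ 𝟙 (third L x y ∈? T₃)
      third∈ x y = 𝟙-cong (E?′ x y) (third L x y ∈? T₃)
        (λ { (t , t∈T , r) → subst (_∈ T₃) (third-unique L r) t∈T })
        (λ t∈T → third L x y , t∈T , R-third L x y)

    -- The map `third L x` is a bijection, and the neighbours of `x` are the preimage of `T₃` under
    -- it.
    graph-row : ∀ x → ∑[ y ← allFin d ] 𝟙 (E?′ x y) ≡ card T₃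
    graph-row x = trans (∑-cong (allFin d) (third∈ x))
      (trans (∑-reindex Finₚ._≟_ (allFin d) (allFin-enumerates d) (third L x) (λ z → second L z x)
                (λ y → sym (second-unique L (R-third L x y)))
                (λ z → sym (third-unique L (R-second L z x))) (λ z → 𝟙 (z ∈? T₃)))
             (card-∑ T₃))

    graph-col : ∀ y → ∑[ x ← allFin d ] 𝟙 (E?′ x y) ≡ card T₃
    graph-col y = trans (∑-cong (allFin d) (λ x → third∈ x y))
      (trans (∑-reindex Finₚ._≟_ (allFin d) (allFin-enumerates d) (λ x → third L x y) (first L y)
                (λ x → sym (first-unique L (R-third L x y)))
                (λ z → sym (third-unique L (R-first L y z))) (λ z → 𝟙 (z ∈? T₃)))
             (card-∑ T₃))

    -- This is `degree-sum` for degree `s * N`, divided by `s`: only the ratio `N` of the degree to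
    -- the threshold remains. For large `N` it says that `card X + card Y` is at most about `d`.
    light⇒small : ∀ s N .{{_ : NonZero s}} → card T₃ ≡ s * N → ∀ X Y →
                  ¬ (∃ λ x → x ∈ X × s ≤ degree E?′ x Y) → card X * N + card Y * N ≤ card X + d * N
    light⇒small s N eq X Y light = ℕₚ.*-cancelˡ-≤ s (begin
      s * (card X * N + card Y * N)
        ≡⟨ lemma₁ s (card X) N (card Y) ⟩
      card X * (s * N) + card Y * (s * N)
        ≤⟨ degree-sum E?′ (λ x → trans (graph-row x) eq) (λ y → trans (graph-col y) eq) X Y
             (λ x x∈X → ℕₚ.≰⇒≥ λ s≤ → light (x , x∈X , s≤)) ⟩
      card X * s + d * (s * N)
        ≡⟨ lemma₂ s (card X) d N ⟩
      s * (card X + d * N) ∎)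
      where
      open ℕₚ.≤-Reasoning
      lemma₁ : ∀ s x N y → s * (x * N + y * N) ≡ x * (s * N) + y * (s * N)
      lemma₁ = solve-∀
      lemma₂ : ∀ s x d N → x * s + d * (s * N) ≡ s * (x + d * N)
      lemma₂ = solve-∀

  module _ {d : ℕ} (L : Latin d) {T₁ T₂ T₃ : Subset d} (s N : ℕ) .{{_ : NonZero s}}
           (T₁≡ : card T₁ ≡ s * N) (T₂≡ : card T₂ ≡ s * N) (T₃≡ : card T₃ ≡ s * N) where

    private
      c : Conflict d
      c = graph L T₁ T₂ T₃

    -- Each side occurs in two of the three inequalities, so their sum reads
    -- `2N * size ≤ size + 3N * d`. Cancelling one copy of the size explains `n = 2N - 1`.
    light-state : ∀ n → suc n ≡ N + N → ∀ X Y Z →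
      ¬ (∃ λ x → x ∈ X × s ≤ degree (E? c) x Y) →
      ¬ (∃ λ y → y ∈ Y × s ≤ degree (F? c) y Z) →
      ¬ (∃ λ z → z ∈ Z × s ≤ degree (G? c) z X) →
      n * (card X + (card Y + card Z)) ≤ 3 * N * d
    light-state n n≡ X Y Z lx ly lz = ℕₚ.+-cancelˡ-≤ (card X + (card Y + card Z)) _ _ (begin
      suc n * (card X + (card Y + card Z))
        ≡⟨ cong (_* (card X + (card Y + card Z))) n≡ ⟩
      (N + N) * (card X + (card Y + card Z))
        ≡⟨ lemma₁ N (card X) (card Y) (card Z) ⟩
      (card X * N + card Y * N) + ((card Y * N + card Z * N) + (card Z * N + card X * N))
        -- The relation `E` of the graph of `rotateᴸ L` on `T₂`, `T₃`, `T₁` is the relation `F` of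
        -- `c`; a second rotation gives `G`.
        ≤⟨ ℕₚ.+-mono-≤ (light⇒small L T₁ T₂ T₃ s N T₃≡ X Y lx)
           (ℕₚ.+-mono-≤ (light⇒small (rotateᴸ L) T₂ T₃ T₁ s N T₁≡ Y Z ly)
                        (light⇒small (rotateᴸ (rotateᴸ L)) T₃ T₁ T₂ s N T₂≡ Z X lz)) ⟩
      (card X + d * N) + ((card Y + d * N) + (card Z + d * N))
        ≡⟨ lemma₂ N (card X) (card Y) (card Z) d ⟩
      card X + (card Y + card Z) + 3 * N * d ∎)
      where
      open ℕₚ.≤-Reasoning
      lemma₁ : ∀ N x y z → (N + N) * (x + (y + z)) ≡ (x * N + y * N) + ((y * N + z * N) + (z * N + x * N))
      lemma₁ = solve-∀
      lemma₂ : ∀ N x y z d → (x + d * N) + ((y + d * N) + (z + d * N)) ≡ x + (y + z) + 3 * N * d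
      lemma₂ = solve-∀

    graph-branch : ∀ M n → suc n ≡ N + N → (∀ u → n * u ≤ 3 * N * d → 2 ^ u ≤ M) → ∀ U →
      countˢ c U ≤ M ⊎ Split c s U
    graph-branch M n n≡ leaf (X , Y , Z)
      with heavy? (E? c) s X Y | heavy? (F? c) s Y Z | heavy? (G? c) s Z X
    ... | no lx | no ly | no lz = inj₁ (ℕₚ.≤-trans (count≤2^ c X Y Z) (leaf _ (light-state n n≡ X Y Z lx ly lz)))
    ... | yes hx | _ | _ = inj₂ (split-heavy c s X Y Z hx)
    ... | _ | yes hy | _ = inj₂ (split-rotate c s X Y Z (split-heavy (rotate c) s Y Z X hy))
    ... | _ | _ | yes hz = inj₂ (split-rotate c s X Y Z (split-rotate (rotate c) s Y Z X
                                   (split-heavy (rotate (rotate c)) s Z X Y hz)))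

    -- The full state has size `3d`, so branching contributes `(1 + 1/m)^(3d)`. The leaves
    -- contribute 2 to the power `3Nd/n`, which is at most `(b/a)^d` by the last hypothesis.
    graph-bound : ∀ m n a b .{{_ : NonZero n}} → suc n ≡ N + N → m ^ suc s ≤ suc m ^ s →
                  2 ^ (3 * N) * a ^ n ≤ b ^ n →
                  count c ⊤ ⊤ ⊤ * (m ^ 3 * a) ^ d ≤ (suc m ^ 3 * b) ^ d
    graph-bound m n a b n≡ ratio h = begin
      count c ⊤ ⊤ ⊤ * (m ^ 3 * a) ^ d
        ≡⟨ cong (count c ⊤ ⊤ ⊤ *_) (power m a) ⟩
      count c ⊤ ⊤ ⊤ * (m ^ (3 * d) * a ^ d)
        ≡⟨ ℕₚ.*-assoc (count c ⊤ ⊤ ⊤) _ _ ⟨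
      count c ⊤ ⊤ ⊤ * m ^ (3 * d) * a ^ d
        ≤⟨ ℕₚ.*-monoˡ-≤ (a ^ d) (branching (countˢ c) size (2 ^ q) s m ratio
             (graph-branch (2 ^ q) n n≡ leaf) (3 * d) (⊤ , ⊤ , ⊤) (ℕₚ.≤-reflexive full)) ⟩
      suc m ^ (3 * d) * 2 ^ q * a ^ d
        ≡⟨ ℕₚ.*-assoc (suc m ^ (3 * d)) _ _ ⟩
      suc m ^ (3 * d) * (2 ^ q * a ^ d)
        ≤⟨ ℕₚ.*-monoʳ-≤ (suc m ^ (3 * d)) (root-bound n {c = 3 * N} h d q
             (ℕₚ.≤-trans (ℕₚ.≤-reflexive (ℕₚ.*-comm n q)) (m/n*n≤m (3 * N * d) n))) ⟩
      suc m ^ (3 * d) * b ^ d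
        ≡⟨ power (suc m) b ⟨
      (suc m ^ 3 * b) ^ d ∎
      where
      open ℕₚ.≤-Reasoning
      q : ℕ
      q = 3 * N * d / n
      -- The size `u` is an integer, so rounding the exponent `3 * N * d / n` down is harmless.
      leaf : ∀ u → n * u ≤ 3 * N * d → 2 ^ u ≤ 2 ^ q
      leaf u nu≤ = ℕₚ.^-monoʳ-≤ 2 (ℕₚ.≤-trans (ℕₚ.≤-reflexive (trans (sym (m*n/n≡m u n)) (cong (_/ n) (ℕₚ.*-comm u n))))
                                     (/-monoˡ-≤ n nu≤))
      power : ∀ m a → (m ^ 3 * a) ^ d ≡ m ^ (3 * d) * a ^ d
      power m a = trans (^-distribʳ-* (m ^ 3) a d) (cong (_* a ^ d) (ℕₚ.^-*-assoc m 3 d))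
      full : size {d} (⊤ , ⊤ , ⊤) ≡ 3 * d
      full = trans (cong₂ _+_ (∣⊤∣≡n d) (cong₂ _+_ (∣⊤∣≡n d) (∣⊤∣≡n d))) (lemma d)
        where
        lemma : ∀ d → d + (d + d) ≡ 3 * d
        lemma = solve-∀

  -- Choosing and deleting elements of a subset

  card-delete : ∀ {n} {A : Subset n} {x} → x ∈ A → suc (card (A - x)) ≡ card A
  card-delete {A = inside ∷ A} here = cong (suc ∘ card) (p─⊥≡p A)
  card-delete {A = inside ∷ A}  (there x∈A) = cong suc (card-delete x∈A)
  card-delete {A = outside ∷ A} (there x∈A) = card-delete x∈A

  x∉A-x : ∀ {n} (A : Subset n) x → x ∉ A - x
  x∉A-x A x x∈ = ℕₚ.1+n≢n (trans (card-delete x∈) (cong card (sym (p─q─q≡p─q A ⁅ x ⁆))))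

  card>0⇒nonempty : ∀ {n} (A : Subset n) → 0 < card A → Nonempty A
  card>0⇒nonempty {n} A 0<card with nonempty? A
  ... | yes ne = ne
  ... | no  em = contradiction 0<card (ℕₚ.<-irrefl (sym (trans (cong card (Empty-unique em)) (∣⊥∣≡0 n))))

  two-elements : ∀ {n} (A : Subset n) → 2 ≤ card A → ∃₂ λ x y → x ∈ A × y ∈ A × x ≢ y
  two-elements A 2≤card with card>0⇒nonempty A (ℕₚ.<-trans (s≤s z≤n) 2≤card)
  ... | x , x∈A with card>0⇒nonempty (A - x) (ℕ.s≤s⁻¹ (ℕₚ.≤-trans 2≤card (ℕₚ.≤-reflexive (sym (card-delete x∈A)))))
  ... | y , y∈A-x = x , y , x∈A , p─q⊆p A ⁅ x ⁆ y∈A-x , λ { refl → x∉A-x A x y∈A-x }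

  -- A graph on two sides only: the third side is inert.
  shift : ∀ {d} → (Fin d → Fin d) → Conflict d
  shift σ = conflict {E = λ y z → (y ≡ z) ⊎ (σ y ≡ z)} {F = λ _ _ → ∅} {G = λ _ _ → ∅}
    (λ y z → (y Finₚ.≟ z) ⊎-dec (σ y Finₚ.≟ z)) (λ _ _ → no id) (λ _ _ → no id)

  module _ {d : ℕ} (σ τ : Fin d → Fin d) (τσ : ∀ x → τ (σ x) ≡ x) (στ : ∀ x → σ (τ x) ≡ x)
           (σ-free : ∀ x → σ x ≢ x) where

    private
      c : Conflict d
      c = shift σ

      h : Subset d → Subset d → ℕ
      h Y Z = count c Y Z ⊥

      h-deleteʳ : ∀ Y Z z → h Y Z ≤ 2 * h Y (Z - z)
      h-deleteʳ Y Z z = subst₂ (λ a b → a ≤ 2 * b) (sym (count-rotate c Y Z ⊥))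
        (sym (count-rotate c Y (Z - z) ⊥)) (count-delete (rotate c) Z ⊥ Y z)

      avoid⊆₁ : ∀ y Z → avoid (E? c) y Z ⊆ Z - y
      avoid⊆₁ y Z z∈ with ∈⟦⟧⁻ (λ z → (z ∈? Z) ×-dec ¬? (E? c y z)) z∈
      ... | z∈Z , ¬e = x∈p∧x≢y⇒x∈p-y z∈Z λ z≡y → ¬e (inj₁ (sym z≡y))

      avoid⊆₂ : ∀ y Z → avoid (E? c) y Z ⊆ Z - y - σ y
      avoid⊆₂ y Z z∈ = x∈p∧x≢y⇒x∈p-y (avoid⊆₁ y Z z∈) λ z≡σy →
        proj₂ (∈⟦⟧⁻ (λ z → (z ∈? Z) ×-dec ¬? (E? c y z)) z∈) (inj₂ (sym z≡σy))

      -- The two copies of `y` span an edge, which has 3 independent sets. Keeping the same set `P`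
      -- on both sides lets whole edges of this kind be cut off.
      three : ∀ P y → h P P ≤ 3 * h (P - y) (P - y)
      three P y = begin
        h P P
          ≤⟨ count-branch c P P ⊥ y ⟩
        h (P - y) P + h (P - y) (avoid (E? c) y P)
          ≤⟨ ℕₚ.+-mono-≤ (h-deleteʳ (P - y) P y) (count-mono c id (avoid⊆₁ y P) id) ⟩
        2 * h (P - y) (P - y) + h (P - y) (P - y)
          ≡⟨ ℕₚ.+-comm (2 * h (P - y) (P - y)) _ ⟩
        3 * h (P - y) (P - y) ∎
        where open ℕₚ.≤-Reasoning

      -- Right `y`, left `y`, right `σ y`, left `σ y` form a path in this order. Without left `y`
      -- there are 2 choices for right `y` and 3 for the edge at `σ y`; with left `y` both right
      -- vertices are excluded and 2 choices remain.
      eight : ∀ P y → h P P ≤ 8 * h (P - y - σ y) (P - y - σ y)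
      eight P y = begin
        h P P
          ≤⟨ count-branch c P P ⊥ y ⟩
        h (P - y) P + h (P - y) (avoid (E? c) y P)
          ≤⟨ ℕₚ.+-mono-≤ (ℕₚ.≤-trans (h-deleteʳ (P - y) P y) (ℕₚ.*-monoʳ-≤ 2 (three (P - y) (σ y))))
               (ℕₚ.≤-trans (count-mono c id (avoid⊆₂ y P) id) (count-delete c (P - y) Q ⊥ (σ y))) ⟩
        2 * (3 * h Q Q) + 2 * h Q Q
          ≡⟨ lemma (h Q Q) ⟩
        8 * h Q Q ∎
        where
        open ℕₚ.≤-Reasoning
        Q : Subset d
        Q = P - y - σ y
        lemma : ∀ a → 2 * (3 * a) + 2 * a ≡ 8 * a
        lemma = solve-∀

      all-singles : ∀ n P → card P ≡ n → h P P ≤ 3 ^ n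
      all-singles n P eq with nonempty? P
      all-singles zero P eq | no em = ℕₚ.≤-trans (count≤2^ c P P ⊥)
        (ℕₚ.≤-reflexive (cong (2 ^_) (cong₂ _+_ eq (cong₂ _+_ eq (∣⊥∣≡0 d)))))
      all-singles (suc n) P eq | no em = contradiction (card>0⇒nonempty P (ℕₚ.<-≤-trans (s≤s z≤n) (ℕₚ.≤-reflexive (sym eq)))) em
      all-singles zero P eq | yes (y , y∈P) = contradiction (trans (card-delete y∈P) eq) λ ()
      all-singles (suc n) P eq | yes (y , y∈P) = ℕₚ.≤-trans (three P y)
        (ℕₚ.*-monoʳ-≤ 3 (all-singles n (P - y) (ℕₚ.suc-injective (trans (card-delete y∈P) eq))))

      -- The set `P` and its preimage under `σ` are disjoint and have the same size.
      sparse : ∀ P → (∀ y → y ∈ P → σ y ∉ P) → card P + card P ≤ d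
      sparse P free = begin
        card P + card P
          ≡⟨ cong₂ _+_ (card-∑ P) (trans (∑-reindex Finₚ._≟_ (allFin d) (allFin-enumerates d) σ τ τσ στ (λ y → 𝟙 (y ∈? P))) (card-∑ P)) ⟨
        (∑[ y ← allFin d ] 𝟙 (y ∈? P)) + (∑[ y ← allFin d ] 𝟙 (σ y ∈? P))
          ≡⟨ ∑-+ (allFin d) _ _ ⟨
        ∑[ y ← allFin d ] (𝟙 (y ∈? P) + 𝟙 (σ y ∈? P))
          ≤⟨ ∑-mono (allFin d) (λ y → go y (y ∈? P)) ⟩
        ∑[ _ ← allFin d ] 1
          ≡⟨ ∑-allFin-1 d ⟩
        d ∎
        where
        open ℕₚ.≤-Reasoning
        go : ∀ y (p : Dec (y ∈ P)) → 𝟙 p + 𝟙 (σ y ∈? P) ≤ 1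
        go y (yes y∈P) = ℕₚ.≤-reflexive (cong suc (𝟙-no (σ y ∈? P) (free y y∈P)))
        go y (no _)    = 𝟙≤1 (σ y ∈? P)

      card-delete₂ : ∀ {P y} → y ∈ P → σ y ∈ P → suc (suc (card (P - y - σ y))) ≡ card P
      card-delete₂ {P} {y} y∈P σy∈P =
        trans (cong suc (card-delete (x∈p∧x≢y⇒x∈p-y σy∈P (σ-free y)))) (card-delete y∈P)

      -- Pairs `y`, `σ y` are removed as long as `P` contains one. Here `j` counts the paths cut off
      -- and `r` the single edges left at the end, which `sparse` limits to `d/2`.
      greedy : ∀ n P → card P ≤ n →
               ∃₂ λ j r → j + (j + r) ≡ card P × r + r ≤ d × h P P ≤ 8 ^ j * 3 ^ r
      greedy n P card≤n with any? (λ y → (y ∈? P) ×-dec (σ y ∈? P))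
      ... | no none = 0 , card P , refl , sparse P (λ y y∈P σy∈P → none (y , y∈P , σy∈P)) ,
            ℕₚ.≤-trans (all-singles (card P) P refl) (ℕₚ.≤-reflexive (sym (ℕₚ.+-identityʳ _)))
      greedy zero    P card≤n | yes (y , y∈P , _) =
        contradiction (ℕₚ.≤-trans (ℕₚ.≤-reflexive (card-delete y∈P)) card≤n) λ ()
      greedy (suc n) P card≤n | yes (y , y∈P , σy∈P)
        with greedy n (P - y - σ y) (ℕ.s≤s⁻¹ (ℕₚ.≤-trans (ℕₚ.≤-trans (s≤s (ℕₚ.n≤1+n _)) (ℕₚ.≤-reflexive (card-delete₂ y∈P σy∈P))) card≤n))
      ... | j , r , eq , r+r≤d , h≤ = suc j , r ,
        trans (cong suc (ℕₚ.+-suc j (j + r))) (trans (cong (2 +_) eq) (card-delete₂ y∈P σy∈P)) ,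
        r+r≤d , ℕₚ.≤-trans (eight P y) (ℕₚ.≤-trans (ℕₚ.*-monoʳ-≤ 8 h≤) (ℕₚ.≤-reflexive (sym (ℕₚ.*-assoc 8 (8 ^ j) (3 ^ r)))))

    shift-bound : count (shift σ) ⊤ ⊤ ⊥ * 50 ^ d ≤ 147 ^ d
    shift-bound with greedy d ⊤ (ℕₚ.≤-reflexive (∣⊤∣≡n d))
    ... | j , r , eq , r+r≤d , h≤ =
      ℕₚ.≤-trans (ℕₚ.*-monoˡ-≤ (50 ^ d) h≤) (pairs-bound d j r (trans eq (∣⊤∣≡n d)) r+r≤d)

  -- Independent triples with a part of one or at least two elements

  Indep : ∀ {d} → Latin d → (A B C : Subset d) → Set
  Indep L A B C = ∀ x y z → x ∈ A → y ∈ B → z ∈ C → ¬ R L x y z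

  indep? : ∀ {d} (L : Latin d) A B C → Dec (Indep L A B C)
  indep? L A B C = all? λ x → all? λ y → all? λ z →
    (x ∈? A) →-dec (y ∈? B) →-dec (z ∈? C) →-dec ¬? (R? L x y z)

  module _ {d : ℕ} (L : Latin d) where
    -- Relabels the third side by the second along `x`: the point `third L x y` gets the label `y`,
    -- so a conflict caused by `x` becomes an equality of labels.
    pullback : Fin d → Subset d → Subset d
    pullback x C = ⟦ (λ y → third L x y ∈? C) ⟧

    ∑-pullback : ∀ x (f : Subset d → ℕ) → ∑[ C ← subsets d ] f (pullback x C) ≡ ∑ (subsets d) f
    ∑-pullback x = ∑-reindex _≟ˢ_ (subsets d) (subsets-enumerates d) (pullback x) back
      (λ C → ⊆-antisym
        (λ {z} z∈ → subst (_∈ C) (sym (third-unique L (R-second L z x))) (∈⟦⟧⁻ (λ y → third L x y ∈? C) (∈⟦⟧⁻ (λ z → second L z x ∈? pullback x C) z∈)))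
        (λ {z} z∈ → ∈⟦⟧⁺ (λ z → second L z x ∈? pullback x C) (∈⟦⟧⁺ (λ y → third L x y ∈? C) (subst (_∈ C) (third-unique L (R-second L z x)) z∈))))
      (λ C → ⊆-antisym
        (λ {y} y∈ → subst (_∈ C) (sym (second-unique L (R-third L x y))) (∈⟦⟧⁻ (λ z → second L z x ∈? C) (∈⟦⟧⁻ (λ y → third L x y ∈? back C) y∈)))
        (λ {y} y∈ → ∈⟦⟧⁺ (λ y → third L x y ∈? back C) (∈⟦⟧⁺ (λ z → second L z x ∈? C) (subst (_∈ C) (second-unique L (R-third L x y)) y∈))))
      where
      back : Subset d → Subset d
      back C = ⟦ (λ z → second L z x ∈? C) ⟧

    -- After relabelling along `x`, independence means that `B` and the relabelled `C` are disjoint.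
    singleton-count : ∀ x → ∑[ B ← subsets d ] ∑[ C ← subsets d ] 𝟙 (indep? L ⁅ x ⁆ B C) ≡ 3 ^ d
    singleton-count x = trans (∑-cong (subsets d) λ B → trans
      (∑-cong (subsets d) λ C → 𝟙-cong (indep? L ⁅ x ⁆ B C) (disjoint? B (pullback x C))
        (λ ind y y∈B y∈C → ind x y (third L x y) (x∈⁅x⁆ x) y∈B (∈⟦⟧⁻ (λ y → third L x y ∈? C) y∈C) (R-third L x y))
        (λ dis x′ y z x′∈ y∈B z∈C r → dis y y∈B (∈⟦⟧⁺ (λ y → third L x y ∈? C)
          (subst (_∈ C) (trans (third-unique L r) (cong (λ x → third L x y) (x∈⁅y⁆⇒x≡y x x′∈))) z∈C))))
      (∑-pullback x (λ C → 𝟙 (disjoint? B C)))) (∑-disjoint d)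

    -- Only the conflicts caused by two elements of `A` are kept. With the third side relabelled
    -- along `x₁`, those of `x₁` join `y` to `y` and those of `x₂` join `y` to `σ y`, which is the
    -- graph `shift σ`.
    pair-bound : ∀ A → 2 ≤ card A →
      (∑[ B ← subsets d ] ∑[ C ← subsets d ] 𝟙 (indep? L A B C)) * 50 ^ d ≤ 147 ^ d
    pair-bound A 2≤card with two-elements A 2≤card
    ... | x₁ , x₂ , x₁∈A , x₂∈A , x₁≢x₂ =
      ℕₚ.≤-trans (ℕₚ.*-monoˡ-≤ (50 ^ d) (∑-mono (subsets d) step)) (shift-bound σ τ τσ στ σ-free)
      where
      σ τ : Fin d → Fin d
      -- For addition this is `y + x₂ - x₁`; it has no fixed point because `x₁ ≢ x₂`.
      σ y = second L (third L x₂ y) x₁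
      τ y = second L (third L x₁ y) x₂
      inverse : ∀ x x′ y → second L (third L x (second L (third L x′ y) x)) x′ ≡ y
      inverse x x′ y = trans (cong (λ z → second L z x′) (sym (third-unique L (R-second L (third L x′ y) x))))
                             (sym (second-unique L (R-third L x′ y)))
      τσ : ∀ y → τ (σ y) ≡ y
      τσ = inverse x₁ x₂
      στ : ∀ y → σ (τ y) ≡ y
      στ = inverse x₂ x₁
      σ-free : ∀ y → σ y ≢ y
      σ-free y σy≡y = x₁≢x₂ (trans (first-unique L (subst (λ y′ → R L x₁ y′ (third L x₂ y)) σy≡y (R-second L (third L x₂ y) x₁)))
                                   (sym (first-unique L (R-third L x₂ y))))
      c : Conflict d
      c = shift σ
      step : ∀ B → ∑[ C ← subsets d ] 𝟙 (indep? L A B C) ≤ ∑[ C ← subsets d ] ∑[ D ← subsets d ] 𝟙 (fits? c ⊤ ⊤ ⊥ B C D)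
      step B = begin
        ∑[ C ← subsets d ] 𝟙 (indep? L A B C)
          ≤⟨ ∑-mono (subsets d) (λ C → 𝟙-mono (indep? L A B C) (fits? c ⊤ ⊤ ⊥ B (pullback x₁ C) ⊥) λ ind →
               (⊆-max B , ⊆-max _ , id) , (λ y z y∈B z∈ → conflict-free C ind y z y∈B (∈⟦⟧⁻ (λ y → third L x₁ y ∈? C) z∈)) , (λ _ _ _ _ ()) , (λ _ _ _ _ ())) ⟩
        ∑[ C ← subsets d ] 𝟙 (fits? c ⊤ ⊤ ⊥ B (pullback x₁ C) ⊥)
          ≡⟨ ∑-pullback x₁ (λ C → 𝟙 (fits? c ⊤ ⊤ ⊥ B C ⊥)) ⟩
        ∑[ C ← subsets d ] 𝟙 (fits? c ⊤ ⊤ ⊥ B C ⊥)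
          -- The inert third side enters through the single term `D = ⊥`.
          ≤⟨ ∑-mono (subsets d) (λ C → ≤∑ (λ D → 𝟙 (fits? c ⊤ ⊤ ⊥ B C D)) (∈-subsets ⊥)) ⟩
        ∑[ C ← subsets d ] ∑[ D ← subsets d ] 𝟙 (fits? c ⊤ ⊤ ⊥ B C D) ∎
        where
        open ℕₚ.≤-Reasoning
        conflict-free : ∀ C → Indep L A B C → ∀ y z → y ∈ B → third L x₁ z ∈ C → ¬ ((y ≡ z) ⊎ (σ y ≡ z))
        conflict-free C ind y z y∈B z∈ (inj₁ refl) = ind x₁ y _ x₁∈A y∈B z∈ (R-third L x₁ y)
        conflict-free C ind y z y∈B z∈ (inj₂ refl) = ind x₂ y _ x₂∈A y∈B
          (subst (_∈ C) (sym (third-unique L (R-second L (third L x₂ y) x₁))) z∈) (R-third L x₂ y)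

  -- The main term and the remainder

  shrink : ∀ {n} k (A : Subset n) → k ≤ card A → ∃ λ T → T ⊆ A × card T ≡ k
  shrink {n} zero A             _       = ⊥ , ⊆-min A , ∣⊥∣≡0 n
  shrink (suc k) (inside ∷ A)  (s≤s k≤) with shrink k A k≤
  ... | T , T⊆A , eq = inside ∷ T , in⊆in T⊆A , cong suc eq
  shrink (suc k) (outside ∷ A) k≤ with shrink (suc k) A k≤
  ... | T , T⊆A , eq = outside ∷ T , out⊆ T⊆A , eq

  module _ {d : ℕ} where

    total : Latin d → ℕ
    total L = ∑³ d λ A B C → 𝟙 (indep? L A B C)

    module _ {P : Subset d → Set} (P? : ∀ A → Dec (P A)) where

      restricted : Latin d → ℕ
      restricted L = ∑³ d λ A B C → 𝟙 (P? A) * 𝟙 (indep? L A B C)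

      restricted₂ : ∀ L → ∑³ d (λ A B C → 𝟙 (P? B) * 𝟙 (indep? L A B C)) ≡ restricted (rotateᴸ L)
      restricted₂ L = trans (∑³-rotate (λ A B C → 𝟙 (P? B) * 𝟙 (indep? L A B C))) (∑³-cong λ B C A →
        cong (𝟙 (P? B) *_) (𝟙-cong (indep? L A B C) (indep? (rotateᴸ L) B C A)
          (λ ind y z x y∈ z∈ x∈ → ind x y z x∈ y∈ z∈) (λ ind x y z x∈ y∈ z∈ → ind y z x y∈ z∈ x∈)))

      restricted₃ : ∀ L → ∑³ d (λ A B C → 𝟙 (P? C) * 𝟙 (indep? L A B C)) ≡ restricted (rotateᴸ (rotateᴸ L))
      restricted₃ L = trans (trans (∑³-rotate (λ A B C → 𝟙 (P? C) * 𝟙 (indep? L A B C))) (∑³-cong λ B C A →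
        cong (𝟙 (P? C) *_) (𝟙-cong (indep? L A B C) (indep? (rotateᴸ L) B C A)
          (λ ind y z x y∈ z∈ x∈ → ind x y z x∈ y∈ z∈) (λ ind x y z x∈ y∈ z∈ → ind y z x y∈ z∈ x∈))))
        (restricted₂ (rotateᴸ L))

    small? : (A : Subset d) → Dec (card A ≤ 1)
    small? A = card A ≤? 1

    -- The empty part leaves `B` and `C` arbitrary, which gives `4^d`; each of the `d` singletons
    -- gives `3^d`.
    restricted-small : ∀ L → restricted small? L ≡ 4 ^ d + d * 3 ^ d
    restricted-small L = begin
      restricted small? L
        ≡⟨ ∑³-first (𝟙 ∘ small?) (λ A B C → 𝟙 (indep? L A B C)) ⟩
      ∑[ A ← subsets d ] 𝟙 (card A ≤? 1) * h A
        ≡⟨ ∑-card≤1 d h ⟩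
      h ⊥ + (∑[ x ← allFin d ] h ⁅ x ⁆)
        ≡⟨ cong₂ _+_ empty (trans (∑-cong (allFin d) (singleton-count L))
             (trans (∑-const (allFin d) (3 ^ d)) (cong (_* 3 ^ d) length-allFin))) ⟩
      4 ^ d + d * 3 ^ d ∎
      where
      open ≡-Reasoning
      h : Subset d → ℕ
      h A = ∑[ B ← subsets d ] ∑[ C ← subsets d ] 𝟙 (indep? L A B C)
      length-allFin : length (allFin d) ≡ d
      length-allFin = trans (sym (trans (∑-const (allFin d) 1) (ℕₚ.*-identityʳ _))) (∑-allFin-1 d)
      empty : h ⊥ ≡ 4 ^ d
      empty = begin
        h ⊥
          ≡⟨ (∑-cong (subsets d) λ B → ∑-cong (subsets d) λ C → 𝟙-yes (indep? L ⊥ B C) λ x y z x∈ → ⊥-elim (∉⊥ x∈)) ⟩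
        ∑[ _ ← subsets d ] ∑[ _ ← subsets d ] 1
          ≡⟨ trans (∑-cong (subsets d) λ _ → trans (∑-const (subsets d) 1) (ℕₚ.*-identityʳ _)) (∑-const (subsets d) _) ⟩
        length (subsets d) * length (subsets d)
          ≡⟨ cong₂ _*_ (length-subsets d) (length-subsets d) ⟩
        2 ^ d * 2 ^ d
          ≡⟨ ^-distribʳ-* 2 2 d ⟨
        4 ^ d ∎

    medium? : ∀ k (A : Subset d) → Dec (2 ≤ card A × card A ≤ k)
    medium? k A = (2 ≤? card A) ×-dec (card A ≤? k)

    -- A union bound over the polynomially many sets `A` of size at most `k`, each handled by
    -- `pair-bound`.
    restricted-medium : ∀ k L → restricted (medium? k) L * 50 ^ d ≤ suc d ^ k * 147 ^ d
    restricted-medium k L = begin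
      restricted (medium? k) L * 50 ^ d
        ≡⟨ cong (_* 50 ^ d) (∑³-first (𝟙 ∘ medium? k) (λ A B C → 𝟙 (indep? L A B C))) ⟩
      (∑[ A ← subsets d ] 𝟙 (medium? k A) * h A) * 50 ^ d
        ≡⟨ ∑-*ʳ (subsets d) (50 ^ d) _ ⟨
      ∑[ A ← subsets d ] 𝟙 (medium? k A) * h A * 50 ^ d
        ≤⟨ ∑-mono (subsets d) bound ⟩
      ∑[ A ← subsets d ] 𝟙 (card A ≤? k) * 147 ^ d
        ≡⟨ ∑-*ʳ (subsets d) (147 ^ d) _ ⟩
      (∑[ A ← subsets d ] 𝟙 (card A ≤? k)) * 147 ^ d
        ≤⟨ ℕₚ.*-monoˡ-≤ (147 ^ d) (∑-card≤ d k) ⟩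
      suc d ^ k * 147 ^ d ∎
      where
      open ℕₚ.≤-Reasoning
      h : Subset d → ℕ
      h A = ∑[ B ← subsets d ] ∑[ C ← subsets d ] 𝟙 (indep? L A B C)
      bound : ∀ A → 𝟙 (medium? k A) * h A * 50 ^ d ≤ 𝟙 (card A ≤? k) * 147 ^ d
      bound A = go (2 ≤? card A) (card A ≤? k)
        where
        go : (p : Dec (2 ≤ card A)) (q : Dec (card A ≤ k)) → 𝟙 (p ×-dec q) * h A * 50 ^ d ≤ 𝟙 q * 147 ^ d
        go (yes 2≤) (yes _) = ℕₚ.≤-trans (ℕₚ.≤-reflexive (cong (_* 50 ^ d) (ℕₚ.+-identityʳ (h A))))
          (ℕₚ.≤-trans (pair-bound L A 2≤) (ℕₚ.≤-reflexive (sym (ℕₚ.+-identityʳ _))))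
        go (yes _)  (no _)  = z≤n
        go (no _)   q       = z≤n

    large? : ∀ k (A B C : Subset d) → Dec (k ≤ card A × k ≤ card B × k ≤ card C)
    large? k A B C = (k ≤? card A) ×-dec (k ≤? card B) ×-dec (k ≤? card C)

    large : ℕ → Latin d → ℕ
    large k L = ∑³ d λ A B C → 𝟙 (large? k A B C) * 𝟙 (indep? L A B C)

    -- A triple with large parts fits the graph of any `k`-subsets chosen inside its parts, and
    -- `cover` uses one such choice. Exchanging the sums leaves one graph count for each choice of
    -- `T₁`, `T₂`, `T₃`, and there are at most `(d+1)^(3k)` choices.
    large-bound : ∀ {k p q} L →
      (∀ {T₁ T₂ T₃} → card T₁ ≡ k → card T₂ ≡ k → card T₃ ≡ k → count (graph L T₁ T₂ T₃) ⊤ ⊤ ⊤ * q ≤ p) →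
      large k L * q ≤ suc d ^ k * (suc d ^ k * suc d ^ k) * p
    large-bound {k} {p} {q} L bound = begin
      large k L * q
        ≤⟨ ℕₚ.*-monoˡ-≤ q (∑³-mono cover) ⟩
      ∑³ d (λ A B C → ∑³ d (λ T₁ T₂ T₃ → weight T₁ T₂ T₃ * 𝟙 (fits? (graph L T₁ T₂ T₃) ⊤ ⊤ ⊤ A B C))) * q
        ≡⟨ cong (_* q) exchange ⟩
      ∑³ d (λ T₁ T₂ T₃ → weight T₁ T₂ T₃ * count (graph L T₁ T₂ T₃) ⊤ ⊤ ⊤) * q
        ≡⟨ (trans (sym (∑-*ʳ (subsets d) q _)) (∑-cong (subsets d) λ T₁ →
            trans (sym (∑-*ʳ (subsets d) q _)) (∑-cong (subsets d) λ T₂ → sym (∑-*ʳ (subsets d) q _)))) ⟩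
      ∑³ d (λ T₁ T₂ T₃ → weight T₁ T₂ T₃ * count (graph L T₁ T₂ T₃) ⊤ ⊤ ⊤ * q)
        ≤⟨ ∑³-mono (λ T₁ T₂ T₃ → estimate T₁ T₂ T₃ (card T₁ ≟ k) (card T₂ ≟ k) (card T₃ ≟ k)) ⟩
      ∑³ d (λ T₁ T₂ T₃ → weight T₁ T₂ T₃ * p)
        ≡⟨ (trans (∑-cong (subsets d) λ T₁ → trans (∑-cong (subsets d) λ T₂ → ∑-*ʳ (subsets d) p _) (∑-*ʳ (subsets d) p _))
             (∑-*ʳ (subsets d) p _)) ⟩
      ∑³ d weight * p
        ≡⟨ cong (_* p) (∑³-product {d} (λ T → 𝟙 (card T ≟ k)) _ _) ⟩
      (∑[ T ← subsets d ] 𝟙 (card T ≟ k)) *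
        ((∑[ T ← subsets d ] 𝟙 (card T ≟ k)) * (∑[ T ← subsets d ] 𝟙 (card T ≟ k))) * p
        ≤⟨ ℕₚ.*-monoˡ-≤ p (ℕₚ.*-mono-≤ few (ℕₚ.*-mono-≤ few few)) ⟩
      suc d ^ k * (suc d ^ k * suc d ^ k) * p ∎
      where
      open ℕₚ.≤-Reasoning
      weight : (T₁ T₂ T₃ : Subset d) → ℕ
      weight T₁ T₂ T₃ = 𝟙 (card T₁ ≟ k) * (𝟙 (card T₂ ≟ k) * 𝟙 (card T₃ ≟ k))
      few : ∑[ T ← subsets d ] 𝟙 (card T ≟ k) ≤ suc d ^ k
      few = ℕₚ.≤-trans (∑-mono (subsets d) λ T → 𝟙-mono (card T ≟ k) (card T ≤? k) ℕₚ.≤-reflexive) (∑-card≤ d k)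
      cover : ∀ A B C → 𝟙 (large? k A B C) * 𝟙 (indep? L A B C) ≤
        ∑³ d (λ T₁ T₂ T₃ → weight T₁ T₂ T₃ * 𝟙 (fits? (graph L T₁ T₂ T₃) ⊤ ⊤ ⊤ A B C))
      cover A B C = ℕₚ.≤-trans (ℕₚ.≤-reflexive (sym (𝟙-× (large? k A B C) (indep? L A B C))))
        (𝟙≤ (large? k A B C ×-dec indep? L A B C) λ { ((kA , kB , kC) , ind) →
          witness (shrink k A kA) (shrink k B kB) (shrink k C kC) ind })
        where
        witness : (∃ λ T → T ⊆ A × card T ≡ k) → (∃ λ T → T ⊆ B × card T ≡ k) → (∃ λ T → T ⊆ C × card T ≡ k) →
          Indep L A B C → 1 ≤ ∑³ d (λ T₁ T₂ T₃ → weight T₁ T₂ T₃ * 𝟙 (fits? (graph L T₁ T₂ T₃) ⊤ ⊤ ⊤ A B C))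
        witness (T₁ , T₁⊆ , e₁) (T₂ , T₂⊆ , e₂) (T₃ , T₃⊆ , e₃) ind = begin
          1
            ≡⟨ cong₂ _*_ (cong₂ _*_ (𝟙-yes (card T₁ ≟ k) e₁) (cong₂ _*_ (𝟙-yes (card T₂ ≟ k) e₂) (𝟙-yes (card T₃ ≟ k) e₃)))
                 (𝟙-yes (fits? (graph L T₁ T₂ T₃) ⊤ ⊤ ⊤ A B C)
                   ((⊆-max A , ⊆-max B , ⊆-max C) ,
                    (λ { x y x∈ y∈ (t , t∈ , r) → ind x y t x∈ y∈ (T₃⊆ t∈) r }) ,
                    (λ { y z y∈ z∈ (t , t∈ , r) → ind t y z (T₁⊆ t∈) y∈ z∈ r }) ,
                    (λ { z x z∈ x∈ (t , t∈ , r) → ind x t z x∈ (T₂⊆ t∈) z∈ r }))) ⟨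
          term T₁ T₂ T₃
            ≤⟨ ≤∑ (term T₁ T₂) (∈-subsets T₃) ⟩
          ∑ (subsets d) (term T₁ T₂)
            ≤⟨ ≤∑ (λ T₂ → ∑ (subsets d) (term T₁ T₂)) (∈-subsets T₂) ⟩
          ∑[ T₂ ← subsets d ] ∑ (subsets d) (term T₁ T₂)
            ≤⟨ ≤∑ (λ T₁ → ∑[ T₂ ← subsets d ] ∑ (subsets d) (term T₁ T₂)) (∈-subsets T₁) ⟩
          ∑³ d term ∎
          where
          term : (T₁ T₂ T₃ : Subset d) → ℕ
          term T₁ T₂ T₃ = weight T₁ T₂ T₃ * 𝟙 (fits? (graph L T₁ T₂ T₃) ⊤ ⊤ ⊤ A B C)
      exchange : ∑³ d (λ A B C → ∑³ d (λ T₁ T₂ T₃ → weight T₁ T₂ T₃ * 𝟙 (fits? (graph L T₁ T₂ T₃) ⊤ ⊤ ⊤ A B C)))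
               ≡ ∑³ d (λ T₁ T₂ T₃ → weight T₁ T₂ T₃ * count (graph L T₁ T₂ T₃) ⊤ ⊤ ⊤)
      exchange = trans (∑³-swap {d} (subsets d) _) (∑-cong (subsets d) λ T₁ →
        trans (∑³-swap {d} (subsets d) _) (∑-cong (subsets d) λ T₂ →
        trans (∑³-swap {d} (subsets d) _) (∑-cong (subsets d) λ T₃ → scale (weight T₁ T₂ T₃) (graph L T₁ T₂ T₃))))
        where
        scale : ∀ w c → ∑³ d (λ A B C → w * 𝟙 (fits? c ⊤ ⊤ ⊤ A B C)) ≡ w * count c ⊤ ⊤ ⊤
        scale w c = trans (∑³-first (λ _ → w) (λ A B C → 𝟙 (fits? c ⊤ ⊤ ⊤ A B C))) (∑-*ˡ (subsets d) w _)
      estimate : ∀ T₁ T₂ T₃ (p₁ : Dec (card T₁ ≡ k)) (p₂ : Dec (card T₂ ≡ k)) (p₃ : Dec (card T₃ ≡ k)) →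
        𝟙 p₁ * (𝟙 p₂ * 𝟙 p₃) * count (graph L T₁ T₂ T₃) ⊤ ⊤ ⊤ * q ≤ 𝟙 p₁ * (𝟙 p₂ * 𝟙 p₃) * p
      estimate T₁ T₂ T₃ (yes e₁) (yes e₂) (yes e₃) = ℕₚ.≤-trans
        (ℕₚ.≤-reflexive (cong (_* q) (ℕₚ.+-identityʳ (count (graph L T₁ T₂ T₃) ⊤ ⊤ ⊤))))
        (ℕₚ.≤-trans (bound e₁ e₂ e₃) (ℕₚ.≤-reflexive (sym (ℕₚ.+-identityʳ p))))
      estimate T₁ T₂ T₃ (yes _) (yes _) (no _) = z≤n
      estimate T₁ T₂ T₃ (yes _) (no _)  _      = z≤n
      estimate T₁ T₂ T₃ (no _)  _       _      = z≤n

    crossing : ℕ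
    crossing = ∑³ d λ A B C → 𝟙 (small? A) * 𝟙 (small? B)

    crossing-bound : crossing ≤ suc d ^ 2 * 2 ^ d
    crossing-bound = begin
      crossing
        ≡⟨ (∑³-cong λ A B C → cong (𝟙 (small? A) *_) (sym (ℕₚ.*-identityʳ (𝟙 (small? B))))) ⟩
      ∑³ d (λ A B C → 𝟙 (small? A) * (𝟙 (small? B) * 1))
        ≡⟨ ∑³-product {d} (𝟙 ∘ small?) (𝟙 ∘ small?) (λ _ → 1) ⟩
      (∑[ A ← subsets d ] 𝟙 (small? A)) * ((∑[ A ← subsets d ] 𝟙 (small? A)) * (∑[ A ← subsets d ] 1))
        ≤⟨ ℕₚ.*-mono-≤ (∑-card≤ d 1) (ℕₚ.*-mono-≤ (∑-card≤ d 1) (ℕₚ.≤-reflexive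
             (trans (∑-const (subsets d) 1) (trans (ℕₚ.*-identityʳ _) (length-subsets d))))) ⟩
      suc d ^ 1 * (suc d ^ 1 * 2 ^ d)
        ≡⟨ lemma (suc d) (2 ^ d) ⟩
      suc d ^ 2 * 2 ^ d ∎
      where
      open ℕₚ.≤-Reasoning
      lemma : ∀ a b → a * 1 * (a * 1 * b) ≡ a * (a * 1) * b
      lemma = solve-∀

    unstructured : ℕ → Latin d → ℕ
    unstructured k L = restricted (medium? k) L + restricted (medium? k) (rotateᴸ L)
                     + restricted (medium? k) (rotateᴸ (rotateᴸ L)) + large k L

    -- One quantity serves both directions: `unstructured` covers the triples that the main term
    -- misses, and the multiple of `crossing` those that it counts repeatedly.
    remainder : ℕ → Latin d → ℕ
    remainder k L = unstructured k L + 6 * crossing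

    private
      main : ∀ L → ∑³ d (λ A B C → 𝟙 (small? A) * 𝟙 (indep? L A B C) + 𝟙 (small? B) * 𝟙 (indep? L A B C)
                                    + 𝟙 (small? C) * 𝟙 (indep? L A B C)) ≡ 3 * (4 ^ d + d * 3 ^ d)
      main L = trans (∑³-+ {d} _ _) (trans (cong₂ _+_ (trans (∑³-+ {d} _ _)
        (cong₂ _+_ (restricted-small L) (trans (restricted₂ small? L) (restricted-small (rotateᴸ L)))))
        (trans (restricted₃ small? L) (restricted-small (rotateᴸ (rotateᴸ L))))) (lemma (4 ^ d + d * 3 ^ d)))
        where
        lemma : ∀ a → a + a + a ≡ 3 * a
        lemma = solve-∀

    -- If no part has size at most 1 and none has size between 2 and `k`, then all three parts have
    -- size at least `k`.
    total≤ : ∀ k L → total L ≤ 3 * (4 ^ d + d * 3 ^ d) + remainder k L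
    total≤ k L = begin
      total L
        ≤⟨ ∑³-mono cover ⟩
      ∑³ d (λ A B C → smalls A B C + (mediums A B C + 𝟙 (large? k A B C) * 𝟙 (indep? L A B C)))
        ≡⟨ trans (∑³-+ {d} smalls _) (cong₂ _+_ (main L) (trans (∑³-+ {d} mediums _) (cong (_+ large k L) medium-sum))) ⟩
      3 * (4 ^ d + d * 3 ^ d) + unstructured k L
        ≤⟨ ℕₚ.+-monoʳ-≤ (3 * (4 ^ d + d * 3 ^ d)) (ℕₚ.m≤m+n _ (6 * crossing)) ⟩
      3 * (4 ^ d + d * 3 ^ d) + remainder k L ∎
      where
      open ℕₚ.≤-Reasoning
      smalls mediums : (A B C : Subset d) → ℕ
      smalls A B C = 𝟙 (small? A) * 𝟙 (indep? L A B C) + 𝟙 (small? B) * 𝟙 (indep? L A B C)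
                     + 𝟙 (small? C) * 𝟙 (indep? L A B C)
      mediums A B C = 𝟙 (medium? k A) * 𝟙 (indep? L A B C) + 𝟙 (medium? k B) * 𝟙 (indep? L A B C)
                      + 𝟙 (medium? k C) * 𝟙 (indep? L A B C)
      medium-sum : ∑³ d mediums ≡ restricted (medium? k) L + restricted (medium? k) (rotateᴸ L)
                                  + restricted (medium? k) (rotateᴸ (rotateᴸ L))
      medium-sum = trans (∑³-+ {d} _ _) (cong₂ _+_ (trans (∑³-+ {d} _ _)
        (cong (restricted (medium? k) L +_) (restricted₂ (medium? k) L))) (restricted₃ (medium? k) L))
      cover : ∀ A B C → 𝟙 (indep? L A B C) ≤ smalls A B C + (mediums A B C + 𝟙 (large? k A B C) * 𝟙 (indep? L A B C))
      cover A B C = subst₂ _≤_ (ℕₚ.*-identityˡ _) (distribute (𝟙 (small? A)) (𝟙 (small? B)) (𝟙 (small? C))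
          (𝟙 (medium? k A)) (𝟙 (medium? k B)) (𝟙 (medium? k C)) (𝟙 (large? k A B C)) (𝟙 (indep? L A B C)))
        (ℕₚ.*-monoˡ-≤ (𝟙 (indep? L A B C)) (case (trichotomy A) (trichotomy B) (trichotomy C)))
        where
        distribute : ∀ a b c a′ b′ c′ l i → (a + b + c + (a′ + b′ + c′ + l)) * i ≡
          a * i + b * i + c * i + (a′ * i + b′ * i + c′ * i + l * i)
        distribute = solve-∀
        Trichotomy : Subset d → Set
        Trichotomy A = (1 ≤ 𝟙 (small? A)) ⊎ (1 ≤ 𝟙 (medium? k A)) ⊎ (k ≤ card A)
        trichotomy : ∀ A → Trichotomy A
        trichotomy A with card A ≤? 1
        ... | yes p = inj₁ (ℕₚ.≤-reflexive (sym (𝟙-yes (card A ≤? 1) p)))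
        ... | no ¬p with card A ≤? k
        ...   | yes q = inj₂ (inj₁ (ℕₚ.≤-reflexive (sym (𝟙-yes (medium? k A) (ℕₚ.≰⇒> ¬p , q)))))
        ...   | no ¬q = inj₂ (inj₂ (ℕₚ.≰⇒≥ ¬q))
        case : Trichotomy A → Trichotomy B → Trichotomy C →
          1 ≤ 𝟙 (small? A) + 𝟙 (small? B) + 𝟙 (small? C) +
              (𝟙 (medium? k A) + 𝟙 (medium? k B) + 𝟙 (medium? k C) + 𝟙 (large? k A B C))
        case (inj₁ a) _ _ = ℕₚ.m≤n⇒m≤n+o _ (ℕₚ.m≤n⇒m≤n+o _ (ℕₚ.m≤n⇒m≤n+o _ a))
        case _ (inj₁ b) _ = ℕₚ.m≤n⇒m≤n+o _ (ℕₚ.m≤n⇒m≤n+o _ (ℕₚ.m≤n⇒m≤o+n (𝟙 (small? A)) b))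
        case _ _ (inj₁ c) = ℕₚ.m≤n⇒m≤n+o _ (ℕₚ.m≤n⇒m≤o+n (𝟙 (small? A) + 𝟙 (small? B)) c)
        case (inj₂ (inj₁ a)) _ _ = ℕₚ.m≤n⇒m≤o+n (𝟙 (small? A) + 𝟙 (small? B) + 𝟙 (small? C))
          (ℕₚ.m≤n⇒m≤n+o _ (ℕₚ.m≤n⇒m≤n+o _ (ℕₚ.m≤n⇒m≤n+o _ a)))
        case _ (inj₂ (inj₁ b)) _ = ℕₚ.m≤n⇒m≤o+n (𝟙 (small? A) + 𝟙 (small? B) + 𝟙 (small? C))
          (ℕₚ.m≤n⇒m≤n+o _ (ℕₚ.m≤n⇒m≤n+o _ (ℕₚ.m≤n⇒m≤o+n (𝟙 (medium? k A)) b)))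
        case _ _ (inj₂ (inj₁ c)) = ℕₚ.m≤n⇒m≤o+n (𝟙 (small? A) + 𝟙 (small? B) + 𝟙 (small? C))
          (ℕₚ.m≤n⇒m≤n+o _ (ℕₚ.m≤n⇒m≤o+n (𝟙 (medium? k A) + 𝟙 (medium? k B)) c))
        case (inj₂ (inj₂ a)) (inj₂ (inj₂ b)) (inj₂ (inj₂ c)) =
          ℕₚ.m≤n⇒m≤o+n (𝟙 (small? A) + 𝟙 (small? B) + 𝟙 (small? C))
          (ℕₚ.m≤n⇒m≤o+n (𝟙 (medium? k A) + 𝟙 (medium? k B) + 𝟙 (medium? k C))
            (ℕₚ.≤-reflexive (sym (𝟙-yes (large? k A B C) (a , b , c)))))

    -- A triple with several small parts is counted once for each of them, and the excess over one
    -- is at most the number of pairs of small parts. Each kind of pair contributes a copy of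
    -- `crossing`, where independence is forgotten.
    ≤total : ∀ k L → 3 * (4 ^ d + d * 3 ^ d) ≤ total L + remainder k L
    ≤total k L = begin
      3 * (4 ^ d + d * 3 ^ d)
        ≡⟨ main L ⟨
      ∑³ d (λ A B C → 𝟙 (small? A) * 𝟙 (indep? L A B C) + 𝟙 (small? B) * 𝟙 (indep? L A B C)
                                    + 𝟙 (small? C) * 𝟙 (indep? L A B C))
        ≤⟨ ∑³-mono (λ A B C → go (small? A) (small? B) (small? C) (indep? L A B C)) ⟩
      ∑³ d (λ A B C → 𝟙 (indep? L A B C) + (pairs A B + pairs B C + pairs C A + (pairs A B + pairs B C + pairs C A)))
        ≡⟨ trans (∑³-+ {d} _ _) (cong (total L +_) (trans (∑³-+ {d} _ _) (trans (cong₂ _+_ three three) (lemma crossing)))) ⟩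
      total L + 6 * crossing
        ≤⟨ ℕₚ.+-monoʳ-≤ (total L) (ℕₚ.m≤n+m (6 * crossing) (unstructured k L)) ⟩
      total L + remainder k L ∎
      where
      open ℕₚ.≤-Reasoning
      pairs : (A B : Subset d) → ℕ
      pairs A B = 𝟙 (small? A) * 𝟙 (small? B)
      go : ∀ {P Q S I : Set} (p : Dec P) (q : Dec Q) (s : Dec S) (i : Dec I) →
        𝟙 p * 𝟙 i + 𝟙 q * 𝟙 i + 𝟙 s * 𝟙 i ≤
        𝟙 i + (𝟙 p * 𝟙 q + 𝟙 q * 𝟙 s + 𝟙 s * 𝟙 p + (𝟙 p * 𝟙 q + 𝟙 q * 𝟙 s + 𝟙 s * 𝟙 p))
      go (yes _) (yes _) (yes _) (yes _) = ℕₚ.≤ᵇ⇒≤ 3 7 _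
      go (yes _) (yes _) (no _)  (yes _) = ℕₚ.≤ᵇ⇒≤ 2 3 _
      go (yes _) (no _)  (yes _) (yes _) = ℕₚ.≤ᵇ⇒≤ 2 3 _
      go (no _)  (yes _) (yes _) (yes _) = ℕₚ.≤ᵇ⇒≤ 2 3 _
      go (yes _) (no _)  (no _)  (yes _) = ℕₚ.≤ᵇ⇒≤ 1 1 _
      go (no _)  (yes _) (no _)  (yes _) = ℕₚ.≤ᵇ⇒≤ 1 1 _
      go (no _)  (no _)  (yes _) (yes _) = ℕₚ.≤ᵇ⇒≤ 1 1 _
      go (no _)  (no _)  (no _)  (yes _) = z≤n
      go p q s (no _) rewrite ℕₚ.*-zeroʳ (𝟙 p) | ℕₚ.*-zeroʳ (𝟙 q) | ℕₚ.*-zeroʳ (𝟙 s) = z≤n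
      three : ∑³ d (λ A B C → pairs A B + pairs B C + pairs C A) ≡ crossing + crossing + crossing
      three = trans (∑³-+ {d} _ _) (cong₂ _+_ (trans (∑³-+ {d} _ _) (cong (crossing +_)
        (sym (trans (∑³-rotate (λ A B C → pairs A B)) (∑³-rotate (λ B C A → pairs A B))))))
        (sym (∑³-rotate (λ A B C → pairs A B))))
      lemma : ∀ a → a + a + a + (a + a + a) ≡ 6 * a
      lemma = solve-∀

  -- States that `t` differs from the main term by at most `r`, without subtraction, and that
  -- `r ≤ K (149/50)^d`.
  Estimate : (K d t : ℕ) → Set
  Estimate K d t = ∃ λ r →
    t ≤ 3 * (4 ^ d + d * 3 ^ d) + r × 3 * (4 ^ d + d * 3 ^ d) ≤ t + r × r * 50 ^ d ≤ K * 149 ^ d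

  -- Here `s` is the branching threshold, `N` the ratio of the degree to it, `1 + 1/m` the cost of
  -- branching per vertex, and `b/a` bounds the growth rate of the leaves. The factor `w` brings the
  -- combined rate to denominator 50.
  module _ (s N m n a b w : ℕ) .{{_ : NonZero s}} .{{_ : NonZero n}} .{{_ : NonZero w}}
           (n≡ : suc n ≡ N + N) (ratio : m ^ suc s ≤ suc m ^ s) (root : 2 ^ (3 * N) * a ^ n ≤ b ^ n)
           (w≡ : m ^ 3 * a ≡ w * 50) (≤w : suc m ^ 3 * b ≤ w * 148) where

    private
      k : ℕ
      k = s * N

    large≤ : ∀ {d} (L : Latin d) → large k L * 50 ^ d ≤ suc d ^ k * (suc d ^ k * suc d ^ k) * 148 ^ d
    large≤ {d} L = ℕₚ.*-cancelʳ-≤ _ _ (w ^ d) {{ℕₚ.m^n≢0 w d}} (begin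
      large k L * 50 ^ d * w ^ d
        ≡⟨ trans (ℕₚ.*-assoc (large k L) _ _) (cong (large k L *_)
             (trans (ℕₚ.*-comm (50 ^ d) _) (trans (sym (^-distribʳ-* w 50 d)) (cong (_^ d) (sym w≡))))) ⟩
      large k L * (m ^ 3 * a) ^ d
        ≤⟨ large-bound L (λ e₁ e₂ e₃ → graph-bound L s N e₁ e₂ e₃ m n a b n≡ ratio root) ⟩
      D * (suc m ^ 3 * b) ^ d
        ≤⟨ ℕₚ.*-monoʳ-≤ D (ℕₚ.^-monoˡ-≤ d ≤w) ⟩
      D * (w * 148) ^ d
        ≡⟨ cong (D *_) (trans (^-distribʳ-* w 148 d) (ℕₚ.*-comm (w ^ d) _)) ⟩
      D * (148 ^ d * w ^ d)
        ≡⟨ ℕₚ.*-assoc D _ _ ⟨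
      D * 148 ^ d * w ^ d ∎)
      where
      open ℕₚ.≤-Reasoning
      D : ℕ
      D = suc d ^ k * (suc d ^ k * suc d ^ k)

    -- The exponent `3k + 2` dominates `k` for medium parts, `3k` for large parts and 2 for the
    -- overlaps, and 148 dominates their bases 147, 148 and 100. The factor 10 counts four main
    -- contributions and six overlaps.
    remainder-poly : ∀ {d} (L : Latin d) → remainder k L * 50 ^ d ≤ 10 * (suc d ^ (k + (k + k) + 2) * 148 ^ d)
    remainder-poly {d} L = begin
      remainder k L * 50 ^ d
        ≡⟨ expand (restricted (medium? k) L) (restricted (medium? k) (rotateᴸ L))
             (restricted (medium? k) (rotateᴸ (rotateᴸ L))) (large k L) (crossing {d}) (50 ^ d) ⟩
      restricted (medium? k) L * 50 ^ d + restricted (medium? k) (rotateᴸ L) * 50 ^ d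
        + restricted (medium? k) (rotateᴸ (rotateᴸ L)) * 50 ^ d + large k L * 50 ^ d + 6 * (crossing {d} * 50 ^ d)
        ≤⟨ ℕₚ.+-mono-≤ (ℕₚ.+-mono-≤ (ℕₚ.+-mono-≤ (ℕₚ.+-mono-≤ (med L) (med (rotateᴸ L))) (med (rotateᴸ (rotateᴸ L)))) lar)
             (ℕₚ.*-monoʳ-≤ 6 cro) ⟩
      X + X + X + X + 6 * X
        ≡⟨ collect X ⟩
      10 * X ∎
      where
      open ℕₚ.≤-Reasoning
      e X : ℕ
      e = k + (k + k) + 2
      X = suc d ^ e * 148 ^ d
      expand : ∀ a b c l o p → (a + b + c + l + 6 * o) * p ≡ a * p + b * p + c * p + l * p + 6 * (o * p)
      expand = solve-∀
      collect : ∀ x → x + x + x + x + 6 * x ≡ 10 * x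
      collect = solve-∀
      med : ∀ L → restricted (medium? k) L * 50 ^ d ≤ X
      med L = ℕₚ.≤-trans (restricted-medium k L) (ℕₚ.*-mono-≤
        (ℕₚ.^-monoʳ-≤ (suc d) (ℕₚ.≤-trans (ℕₚ.m≤m+n k (k + k)) (ℕₚ.m≤m+n (k + (k + k)) 2)))
        (ℕₚ.^-monoˡ-≤ d (ℕₚ.≤ᵇ⇒≤ 147 148 _)))
      lar : large k L * 50 ^ d ≤ X
      lar = ℕₚ.≤-trans (large≤ L) (ℕₚ.*-monoˡ-≤ (148 ^ d) (ℕₚ.≤-trans (ℕₚ.≤-reflexive
        (sym (trans (ℕₚ.^-distribˡ-+-* (suc d) k (k + k)) (cong (suc d ^ k *_) (ℕₚ.^-distribˡ-+-* (suc d) k k)))))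
        (ℕₚ.^-monoʳ-≤ (suc d) (ℕₚ.m≤m+n (k + (k + k)) 2))))
      cro : crossing {d} * 50 ^ d ≤ X
      cro = begin
        crossing {d} * 50 ^ d
          ≤⟨ ℕₚ.*-monoˡ-≤ (50 ^ d) (crossing-bound {d}) ⟩
        suc d ^ 2 * 2 ^ d * 50 ^ d
          ≡⟨ trans (ℕₚ.*-assoc (suc d ^ 2) (2 ^ d) (50 ^ d)) (cong (suc d ^ 2 *_) (sym (^-distribʳ-* 2 50 d))) ⟩
        suc d ^ 2 * 100 ^ d
          ≤⟨ ℕₚ.*-mono-≤ (ℕₚ.^-monoʳ-≤ (suc d) (ℕₚ.m≤n+m 2 (k + (k + k)))) (ℕₚ.^-monoˡ-≤ d (ℕₚ.≤ᵇ⇒≤ 100 148 _)) ⟩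
        X ∎

    latin-estimate : ∃ λ K → ∀ {d} (L : Latin d) → Estimate K d (total L)
    -- Raising the base from 148 to 149 absorbs the polynomial factor.
    latin-estimate = finish (poly≤exp (k + (k + k) + 2) ℕₚ.≤-refl)
      where
      finish : (∃ λ K → ∀ d → suc d ^ (k + (k + k) + 2) * 148 ^ d ≤ K * 149 ^ d) → ∃ λ K → ∀ {d} (L : Latin d) → Estimate K d (total L)
      finish (K , bound) = 10 * K , λ {d} L → remainder k L , total≤ k L , ≤total k L ,
        ℕₚ.≤-trans (remainder-poly L)
          (ℕₚ.≤-trans (ℕₚ.*-monoʳ-≤ 10 (bound d)) (ℕₚ.≤-reflexive (sym (ℕₚ.*-assoc 10 K (149 ^ d)))))

  -- Addition modulo `d` as a Latin square

  %-congʳ-+ : ∀ {a b} c d .{{_ : NonZero d}} → a % d ≡ b % d → (c + a) % d ≡ (c + b) % d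
  %-congʳ-+ {a} {b} c d eq = trans (%-distribˡ-+ c a d)
    (trans (cong (λ r → (c % d + r) % d) eq) (sym (%-distribˡ-+ c b d)))

  module _ (d : ℕ) .{{_ : NonZero d}} where

    private
      toℕ-% : (x : Fin d) → toℕ x % d ≡ toℕ x
      toℕ-% x = m<n⇒m%n≡m (Finₚ.toℕ<n x)

      toℕ-mod : ∀ m → toℕ (m mod d) ≡ m % d
      toℕ-mod m = Finₚ.toℕ-fromℕ< (m%n<n m d)

      d∸x+x : (x : Fin d) → d ∸ toℕ x + toℕ x ≡ d
      d∸x+x x = ℕₚ.m∸n+n≡m (ℕₚ.<⇒≤ (Finₚ.toℕ<n x))

      -- The residue `z - x`; subtracting `x` from `d` before adding `z` keeps the truncated
      -- subtraction exact.
      diff : Fin d → Fin d → Fin d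
      diff z x = (d ∸ toℕ x + toℕ z) mod d

      +-diff : ∀ z x → (toℕ x + toℕ (diff z x)) % d ≡ toℕ z % d
      +-diff z x = begin
        (toℕ x + toℕ (diff z x)) % d
          ≡⟨ %-congʳ-+ (toℕ x) d (trans (cong (_% d) (toℕ-mod (d ∸ toℕ x + toℕ z))) (m%n%n≡m%n (d ∸ toℕ x + toℕ z) d)) ⟩
        (toℕ x + (d ∸ toℕ x + toℕ z)) % d
          ≡⟨ cong (_% d) (trans (lemma (toℕ x) (d ∸ toℕ x) (toℕ z)) (cong (toℕ z +_) (d∸x+x x))) ⟩
        (toℕ z + d) % d
          ≡⟨ [m+n]%n≡m%n (toℕ z) d ⟩
        toℕ z % d ∎
        where
        open ≡-Reasoning
        lemma : ∀ x c z → x + (c + z) ≡ z + (c + x)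
        lemma = solve-∀

      diff-unique : ∀ {x y z} → (toℕ x + toℕ y) % d ≡ toℕ z % d → y ≡ diff z x
      diff-unique {x} {y} {z} eq = Finₚ.toℕ-injective (begin
        toℕ y
          ≡⟨ toℕ-% y ⟨
        toℕ y % d
          ≡⟨ [m+n]%n≡m%n (toℕ y) d ⟨
        (toℕ y + d) % d
          ≡⟨ cong (_% d) (trans (lemma (toℕ x) (d ∸ toℕ x) (toℕ y)) (cong (toℕ y +_) (d∸x+x x))) ⟨
        (d ∸ toℕ x + (toℕ x + toℕ y)) % d
          ≡⟨ %-congʳ-+ (d ∸ toℕ x) d eq ⟩
        (d ∸ toℕ x + toℕ z) % d
          ≡⟨ toℕ-mod (d ∸ toℕ x + toℕ z) ⟨
        toℕ (diff z x) ∎)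
        where
        open ≡-Reasoning
        lemma : ∀ x c y → c + (x + y) ≡ y + (c + x)
        lemma = solve-∀

      commute : ∀ (x y : Fin d) {z : Fin d} → (toℕ x + toℕ y) % d ≡ toℕ z % d → (toℕ y + toℕ x) % d ≡ toℕ z % d
      commute x y = trans (cong (_% d) (ℕₚ.+-comm (toℕ y) (toℕ x)))

    addition : Latin d
    addition = record
      { R  = λ x y z → (toℕ x + toℕ y) % d ≡ toℕ z % d
      ; R? = λ x y z → (toℕ x + toℕ y) % d ≟ toℕ z % d
      ; first  = λ y z → diff z y
      ; second = diff
      ; third  = λ x y → (toℕ x + toℕ y) mod d
      ; R-first  = λ y z → commute y (diff z y) (+-diff z y)
      ; R-second = +-diff
      ; R-third  = λ x y → sym (trans (cong (_% d) (toℕ-mod (toℕ x + toℕ y))) (m%n%n≡m%n (toℕ x + toℕ y) d))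
      ; first-unique  = λ {x} {y} eq → diff-unique (commute x y eq)
      ; second-unique = diff-unique
      ; third-unique  = λ {x} {y} {z} eq → Finₚ.toℕ-injective
          (trans (sym (toℕ-% z)) (trans (sym eq) (sym (toℕ-mod (toℕ x + toℕ y)))))
      }

    -- Vertex sets of the hypergraph as triples

    module _ (A B C : Subset d) where

      private
        W : Subset (d + (d + d))
        W = A Vec.++ (B Vec.++ C)

        ∈-V₁ : ∀ x → Vec.lookup W (V₁ x) ≡ Vec.lookup A x
        ∈-V₁ x = lookup-++ˡ A (B Vec.++ C) x
        ∈-V₂ : ∀ y → Vec.lookup W (V₂ y) ≡ Vec.lookup B y
        ∈-V₂ y = trans (lookup-++ʳ A (B Vec.++ C) (y ↑ˡ d)) (lookup-++ˡ B C y)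
        ∈-V₃ : ∀ z → Vec.lookup W (V₃ z) ≡ Vec.lookup C z
        ∈-V₃ z = trans (lookup-++ʳ A (B Vec.++ C) (d ↑ʳ z)) (lookup-++ʳ B C z)

        transport : ∀ {m n} {P : Subset m} {Q : Subset n} {u v} → Vec.lookup P u ≡ Vec.lookup Q v → u ∈ P → v ∈ Q
        transport {Q = Q} {v = v} eq u∈P = lookup⇒[]= v Q (trans (sym eq) ([]=⇒lookup u∈P))

        triple⊆W : ∀ {x y z} → x ∈ A → y ∈ B → z ∈ C → triple x y z ⊆ W
        triple⊆W {x} {y} {z} x∈ y∈ z∈ {v} v∈ with x∈p∪q⁻ ⁅ V₁ x ⁆ (⁅ V₂ y ⁆ ∪ ⁅ V₃ z ⁆) v∈
        ... | inj₁ v∈₁ rewrite x∈⁅y⁆⇒x≡y (V₁ x) v∈₁ = transport (sym (∈-V₁ x)) x∈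
        ... | inj₂ v∈₂₃ with x∈p∪q⁻ ⁅ V₂ y ⁆ ⁅ V₃ z ⁆ v∈₂₃
        ...   | inj₁ v∈₂ rewrite x∈⁅y⁆⇒x≡y (V₂ y) v∈₂ = transport (sym (∈-V₂ y)) y∈
        ...   | inj₂ v∈₃ rewrite x∈⁅y⁆⇒x≡y (V₃ z) v∈₃ = transport (sym (∈-V₃ z)) z∈

      independent⇒indep : Independent (Hmod d) W → Indep addition A B C
      independent⇒indep free x y z x∈ y∈ z∈ r = free (triple x y z , (x , y , z , r , refl) , triple⊆W x∈ y∈ z∈)

      indep⇒independent : Indep addition A B C → Independent (Hmod d) W
      indep⇒independent ind (_ , (x , y , z , r , refl) , ⊆W) = ind x y z
        (transport (∈-V₁ x) (⊆W (x∈p∪q⁺ (inj₁ (x∈⁅x⁆ (V₁ x))))))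
        (transport (∈-V₂ y) (⊆W (x∈p∪q⁺ (inj₂ (x∈p∪q⁺ (inj₁ (x∈⁅x⁆ (V₂ y))))))))
        (transport (∈-V₃ z) (⊆W (x∈p∪q⁺ {p = ⁅ V₁ x ⁆} (inj₂ (x∈p∪q⁺ {p = ⁅ V₂ y ⁆} (inj₂ (x∈⁅x⁆ (V₃ z))))))))
        r

    i≡total : i (Hmod d) ≡ total addition
    i≡total = begin
      i (Hmod d)
        ≡⟨ length-filter (independent? (Hmod d)) (subsets (d + (d + d))) ⟩
      ∑[ W ← subsets (d + (d + d)) ] 𝟙 (independent? (Hmod d) W)
        ≡⟨ trans (∑-subsets-+ d (d + d) _) (∑-cong (subsets d) λ A → ∑-subsets-+ d d _) ⟩
      ∑³ d (λ A B C → 𝟙 (independent? (Hmod d) (A Vec.++ (B Vec.++ C))))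
        ≡⟨ ∑³-cong (λ A B C → 𝟙-cong (independent? (Hmod d) (A Vec.++ (B Vec.++ C))) (indep? addition A B C)
             (independent⇒indep A B C) (indep⇒independent A B C)) ⟩
      total addition ∎
      where open ≡-Reasoning

  -- The constants say 1.01^463 ≥ 100, 2^(300/199) ≤ 2.86 and 1.01³ · 2.86 ≤ 2.96.  The witness
  -- is a power with an exponent above 10⁵, hence the abstract block: it must never be evaluated.
  abstract
    Hmod-estimate : ∃ λ K → ∀ d .{{_ : NonZero d}} → Estimate K d (i (Hmod d))
    Hmod-estimate = transfer (latin-estimate 463 100 100 199 50 143 1000000 refl
        (ℕₚ.≤ᵇ⇒≤ (100 ^ 464) (101 ^ 463) _) (ℕₚ.≤ᵇ⇒≤ (2 ^ 300 * 50 ^ 199) (143 ^ 199) _)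
        refl (ℕₚ.≤ᵇ⇒≤ 147333043 148000000 _))
      where
      transfer : (∃ λ K → ∀ {d} (L : Latin d) → Estimate K d (total L)) →
                 ∃ λ K → ∀ d .{{_ : NonZero d}} → Estimate K d (i (Hmod d))
      transfer (K , bound) = K , λ d → subst (Estimate K d) (sym (i≡total d)) (bound (addition d))

    -- Absorbs the term `d * 3^(d+1)` into `(4 - 1/50)^d`; the bases are 3 and `4 - 1/50` scaled by
    -- 50.
    linear≤exp : ∃ λ K → ∀ d → suc d ^ 1 * 150 ^ d ≤ K * 199 ^ d
    linear≤exp = poly≤exp 1 (ℕₚ.≤ᵇ⇒≤ 151 199 _)

-- From natural numbers to rational numbers

open Counting using (^-distribʳ-*; Estimate; Hmod-estimate; linear≤exp)
open import Data.Integer.Base as ℤ using (+_; +≤+; +<+)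
import Data.Integer.Properties as ℤₚ
open import Data.Rational.Base using (ℚ; 0ℚ; _<_; _≤_; _-_; _+_; -_; _*_; ∣_∣; _/_; toℚᵘ; positive)
open import Data.Rational.Properties as ℚₚ using (toℚᵘ-injective; toℚᵘ-fromℚᵘ; toℚᵘ-homo-+; toℚᵘ-homo-*; toℚᵘ-cancel-≤; toℚᵘ-cancel-<)
open import Data.Rational.Solver using (module +-*-Solver)
open import Data.Rational.Unnormalised.Base as ℚᵘ using (mkℚᵘ; *≡*; *≤*; *<*)
import Data.Rational.Unnormalised.Properties as ℚᵘₚ

module _ where
  open ℚᵘₚ.≃-Reasoning

  fromℕ-ᵘ : ∀ n → toℚᵘ (fromℕ n) ℚᵘ.≃ mkℚᵘ (+ n) 0
  fromℕ-ᵘ n = toℚᵘ-fromℚᵘ (mkℚᵘ (+ n) 0)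

  fromℕ-+ : ∀ m n → fromℕ (m ℕ.+ n) ≡ fromℕ m + fromℕ n
  fromℕ-+ m n = toℚᵘ-injective (begin
    toℚᵘ (fromℕ (m ℕ.+ n))              ≈⟨ fromℕ-ᵘ (m ℕ.+ n) ⟩
    mkℚᵘ (+ (m ℕ.+ n)) 0                ≈⟨ *≡* (cong (ℤ._* + 1) (cong₂ ℤ._+_ (sym (ℤₚ.*-identityʳ (+ m))) (sym (ℤₚ.*-identityʳ (+ n))))) ⟩
    mkℚᵘ (+ m) 0 ℚᵘ.+ mkℚᵘ (+ n) 0      ≈⟨ ℚᵘₚ.+-cong (fromℕ-ᵘ m) (fromℕ-ᵘ n) ⟨
    toℚᵘ (fromℕ m) ℚᵘ.+ toℚᵘ (fromℕ n)  ≈⟨ toℚᵘ-homo-+ (fromℕ m) (fromℕ n) ⟨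
    toℚᵘ (fromℕ m + fromℕ n)            ∎)

  fromℕ-* : ∀ m n → fromℕ (m ℕ.* n) ≡ fromℕ m * fromℕ n
  fromℕ-* m n = toℚᵘ-injective (begin
    toℚᵘ (fromℕ (m ℕ.* n))              ≈⟨ fromℕ-ᵘ (m ℕ.* n) ⟩
    mkℚᵘ (+ (m ℕ.* n)) 0                ≈⟨ *≡* (cong (ℤ._* + 1) (ℤₚ.pos-* m n)) ⟩
    mkℚᵘ (+ m) 0 ℚᵘ.* mkℚᵘ (+ n) 0      ≈⟨ ℚᵘₚ.*-cong (fromℕ-ᵘ m) (fromℕ-ᵘ n) ⟨
    toℚᵘ (fromℕ m) ℚᵘ.* toℚᵘ (fromℕ n)  ≈⟨ toℚᵘ-homo-* (fromℕ m) (fromℕ n) ⟨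
    toℚᵘ (fromℕ m * fromℕ n)            ∎)

fromℕ-mono-≤ : ∀ {m n} → m ℕ.≤ n → fromℕ m ≤ fromℕ n
fromℕ-mono-≤ {m} {n} m≤n = toℚᵘ-cancel-≤ (ℚᵘₚ.≤-respˡ-≃ (ℚᵘₚ.≃-sym (fromℕ-ᵘ m))
  (ℚᵘₚ.≤-respʳ-≃ (ℚᵘₚ.≃-sym (fromℕ-ᵘ n)) (*≤* (ℤₚ.*-monoʳ-≤-nonNeg (+ 1) (+≤+ m≤n)))))

fromℕ-mono-< : ∀ {m n} → m ℕ.< n → fromℕ m < fromℕ n
fromℕ-mono-< {m} {n} m<n = toℚᵘ-cancel-< (ℚᵘₚ.<-respˡ-≃ (ℚᵘₚ.≃-sym (fromℕ-ᵘ m))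
  (ℚᵘₚ.<-respʳ-≃ (ℚᵘₚ.≃-sym (fromℕ-ᵘ n)) (*<* (ℤₚ.*-monoʳ-<-pos (+ 1) (+<+ m<n)))))

0<fromℕ-suc : ∀ n → 0ℚ < fromℕ (suc n)
0<fromℕ-suc n = fromℕ-mono-< {0} {suc n} (ℕ.s≤s ℕ.z≤n)

distance : ∀ x a r → x ℕ.≤ a ℕ.+ r → a ℕ.≤ x ℕ.+ r → ∣ fromℕ x - fromℕ a ∣ ≤ fromℕ r
distance x a r x≤ a≤ with ℚₚ.∣p∣≡p∨∣p∣≡-p (fromℕ x - fromℕ a)
... | inj₁ eq = subst (_≤ fromℕ r) (sym eq) (subst (fromℕ x - fromℕ a ≤_)
  (trans (cong (_- fromℕ a) (fromℕ-+ a r)) (cancel (fromℕ a) (fromℕ r)))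
  (ℚₚ.+-monoˡ-≤ (- fromℕ a) (fromℕ-mono-≤ x≤)))
  where
  open +-*-Solver
  cancel : ∀ p q → p + q - p ≡ q
  cancel = solve 2 (λ p q → p :+ q :- p := q) refl
... | inj₂ eq = subst (_≤ fromℕ r) (sym (trans eq (swap (fromℕ x) (fromℕ a)))) (subst (fromℕ a - fromℕ x ≤_)
  (trans (cong (_- fromℕ x) (fromℕ-+ x r)) (cancel (fromℕ x) (fromℕ r)))
  (ℚₚ.+-monoˡ-≤ (- fromℕ x) (fromℕ-mono-≤ a≤)))
  where
  open +-*-Solver
  cancel : ∀ p q → p + q - p ≡ q
  cancel = solve 2 (λ p q → p :+ q :- p := q) refl
  swap : ∀ p q → - (p - q) ≡ q - p
  swap = solve 2 (λ p q → :- (p :- q) := q :- p) refl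

module _ (p q : ℕ) .{{_ : NonZero q}} (ρ : ℚ) (ρq≡p : ρ * fromℕ q ≡ fromℕ p) where

  ^ℚ-scale : ∀ d → ρ ^ℚ d * fromℕ (q ℕ.^ d) ≡ fromℕ (p ℕ.^ d)
  ^ℚ-scale zero    = refl
  ^ℚ-scale (suc d) = begin
    ρ * ρ ^ℚ d * fromℕ (q ℕ.* q ℕ.^ d)
      ≡⟨ cong (ρ * ρ ^ℚ d *_) (fromℕ-* q (q ℕ.^ d)) ⟩
    ρ * ρ ^ℚ d * (fromℕ q * fromℕ (q ℕ.^ d))
      ≡⟨ solve 4 (λ a b c e → a :* b :* (c :* e) := a :* c :* (b :* e)) refl ρ (ρ ^ℚ d) (fromℕ q) (fromℕ (q ℕ.^ d)) ⟩
    ρ * fromℕ q * (ρ ^ℚ d * fromℕ (q ℕ.^ d))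
      ≡⟨ cong₂ _*_ ρq≡p (^ℚ-scale d) ⟩
    fromℕ p * fromℕ (p ℕ.^ d)
      ≡⟨ fromℕ-* p (p ℕ.^ d) ⟨
    fromℕ (p ℕ.* p ℕ.^ d) ∎
    where
    open ≡-Reasoning
    open +-*-Solver

  -- Turns a bound with cleared denominators into one on the power of `ρ = p/q`, by cancelling the
  -- positive factor `q^d`.
  fromℕ≤^ℚ : ∀ r K d → r ℕ.* q ℕ.^ d ℕ.≤ K ℕ.* p ℕ.^ d → fromℕ r ≤ fromℕ K * ρ ^ℚ d
  fromℕ≤^ℚ r K d h = ℚₚ.*-cancelʳ-≤-pos (fromℕ (q ℕ.^ d)) {{positive (fromℕ-mono-< (ℕₚ.m^n>0 q d))}} (begin
    fromℕ r * fromℕ (q ℕ.^ d)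
      ≡⟨ fromℕ-* r (q ℕ.^ d) ⟨
    fromℕ (r ℕ.* q ℕ.^ d)
      ≤⟨ fromℕ-mono-≤ h ⟩
    fromℕ (K ℕ.* p ℕ.^ d)
      ≡⟨ trans (fromℕ-* K (p ℕ.^ d)) (cong (fromℕ K *_) (sym (^ℚ-scale d))) ⟩
    fromℕ K * (ρ ^ℚ d * fromℕ (q ℕ.^ d))
      ≡⟨ ℚₚ.*-assoc (fromℕ K) _ _ ⟨
    fromℕ K * ρ ^ℚ d * fromℕ (q ℕ.^ d) ∎)
    where open ℚₚ.≤-Reasoning

main-term : ∀ d → 3 ℕ.* (4 ℕ.^ d ℕ.+ d ℕ.* 3 ℕ.^ d) ≡ 3 ℕ.* 4 ℕ.^ d ℕ.+ d ℕ.* 3 ℕ.^ (d ℕ.+ 1)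
main-term d = trans (lemma (4 ℕ.^ d) d (3 ℕ.^ d))
  (cong (λ t → 3 ℕ.* 4 ℕ.^ d ℕ.+ d ℕ.* t) (sym (ℕₚ.^-distribˡ-+-* 3 d 1)))
  where
  lemma : ∀ a d b → 3 ℕ.* (a ℕ.+ d ℕ.* b) ≡ 3 ℕ.* a ℕ.+ d ℕ.* (b ℕ.* 3)
  lemma = solve-∀

module _ (K d t : ℕ) (est : Estimate K d t) where

  private
    a b r : ℕ
    a = 3 ℕ.* 4 ℕ.^ d
    b = d ℕ.* 3 ℕ.^ (d ℕ.+ 1)
    r = proj₁ est

    t≤ : t ℕ.≤ a ℕ.+ b ℕ.+ r
    t≤ = subst (λ m → t ℕ.≤ m ℕ.+ r) (main-term d) (proj₁ (proj₂ est))
    ≤t : a ℕ.+ b ℕ.≤ t ℕ.+ r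
    ≤t = subst (ℕ._≤ t ℕ.+ r) (main-term d) (proj₁ (proj₂ (proj₂ est)))
    r≤ : r ℕ.* 50 ℕ.^ d ℕ.≤ K ℕ.* 149 ℕ.^ d
    r≤ = proj₂ (proj₂ (proj₂ est))

  first-order : ∣ fromℕ t - fromℕ a - fromℕ b ∣ ≤ fromℕ (suc K) * (fromℕ 3 - + 1 / 50) ^ℚ d
  first-order = ℚₚ.≤-trans
    (subst (λ x → ∣ x ∣ ≤ fromℕ r) (trans (cong (λ x → fromℕ t - x) (fromℕ-+ a b)) (regroup (fromℕ t) (fromℕ a) (fromℕ b)))
      (distance t (a ℕ.+ b) r t≤ ≤t))
    -- The `refl` checks `(3 - 1/50) * 50 = 149`. The successor of `K` makes the constant positive.
    (fromℕ≤^ℚ 149 50 (fromℕ 3 - + 1 / 50) refl r (suc K) d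
      (ℕₚ.≤-trans r≤ (ℕₚ.*-monoˡ-≤ (149 ℕ.^ d) (ℕₚ.n≤1+n K))))
    where
    open +-*-Solver
    regroup : ∀ p q s → p - (q + s) ≡ p - q - s
    regroup = solve 3 (λ p q s → p :- (q :+ s) := p :- q :- s) refl

  -- The term `b = d * 3^(d+1)` joins the error. It accounts for `3 * K₁` in the constant, the 3
  -- coming from the extra power of 3.
  zeroth-order : ∀ K₁ → suc d ℕ.^ 1 ℕ.* 150 ℕ.^ d ℕ.≤ K₁ ℕ.* 199 ℕ.^ d →
    ∣ fromℕ t - fromℕ a ∣ ≤ fromℕ (suc (3 ℕ.* K₁ ℕ.+ K)) * (fromℕ 4 - + 1 / 50) ^ℚ d
  zeroth-order K₁ linear = ℚₚ.≤-trans
    (distance t a (b ℕ.+ r) (ℕₚ.≤-trans t≤ (ℕₚ.≤-reflexive (ℕₚ.+-assoc a b r)))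
      (ℕₚ.≤-trans (ℕₚ.m≤m+n a b) (ℕₚ.≤-trans ≤t (ℕₚ.+-monoʳ-≤ t (ℕₚ.m≤n+m r b)))))
    (fromℕ≤^ℚ 199 50 (fromℕ 4 - + 1 / 50) refl (b ℕ.+ r) (suc (3 ℕ.* K₁ ℕ.+ K)) d (begin
      (b ℕ.+ r) ℕ.* 50 ℕ.^ d
        ≡⟨ ℕₚ.*-distribʳ-+ (50 ℕ.^ d) b r ⟩
      b ℕ.* 50 ℕ.^ d ℕ.+ r ℕ.* 50 ℕ.^ d
        ≤⟨ ℕₚ.+-mono-≤ b≤ (ℕₚ.≤-trans r≤ (ℕₚ.*-monoʳ-≤ K (ℕₚ.^-monoˡ-≤ d (ℕₚ.≤ᵇ⇒≤ 149 199 _)))) ⟩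
      3 ℕ.* (K₁ ℕ.* 199 ℕ.^ d) ℕ.+ K ℕ.* 199 ℕ.^ d
        ≡⟨ collect K₁ K (199 ℕ.^ d) ⟩
      (3 ℕ.* K₁ ℕ.+ K) ℕ.* 199 ℕ.^ d
        ≤⟨ ℕₚ.*-monoˡ-≤ (199 ℕ.^ d) (ℕₚ.n≤1+n (3 ℕ.* K₁ ℕ.+ K)) ⟩
      suc (3 ℕ.* K₁ ℕ.+ K) ℕ.* 199 ℕ.^ d ∎))
    where
    open ℕₚ.≤-Reasoning
    collect : ∀ a b c → 3 ℕ.* (a ℕ.* c) ℕ.+ b ℕ.* c ≡ (3 ℕ.* a ℕ.+ b) ℕ.* c
    collect = solve-∀
    reorder : ∀ d x y → d ℕ.* (x ℕ.* 3) ℕ.* y ≡ 3 ℕ.* (d ℕ.* 1 ℕ.* (x ℕ.* y))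
    reorder = solve-∀
    b≤ : b ℕ.* 50 ℕ.^ d ℕ.≤ 3 ℕ.* (K₁ ℕ.* 199 ℕ.^ d)
    b≤ = begin
      d ℕ.* 3 ℕ.^ (d ℕ.+ 1) ℕ.* 50 ℕ.^ d
        ≡⟨ cong (λ t → d ℕ.* t ℕ.* 50 ℕ.^ d) (ℕₚ.^-distribˡ-+-* 3 d 1) ⟩
      d ℕ.* (3 ℕ.^ d ℕ.* 3) ℕ.* 50 ℕ.^ d
        ≡⟨ reorder d (3 ℕ.^ d) (50 ℕ.^ d) ⟩
      3 ℕ.* (d ℕ.* 1 ℕ.* (3 ℕ.^ d ℕ.* 50 ℕ.^ d))
        ≡⟨ cong (λ t → 3 ℕ.* (d ℕ.* 1 ℕ.* t)) (^-distribʳ-* 3 50 d) ⟨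
      3 ℕ.* (d ℕ.* 1 ℕ.* 150 ℕ.^ d)
        ≤⟨ ℕₚ.*-monoʳ-≤ 3 (ℕₚ.≤-trans (ℕₚ.*-monoˡ-≤ (150 ℕ.^ d) (ℕₚ.*-monoˡ-≤ 1 (ℕₚ.n≤1+n d))) linear) ⟩
      3 ℕ.* (K₁ ℕ.* 199 ℕ.^ d) ∎

theorem1 : Σ[ c ∈ ℚ ] Σ[ K ∈ ℚ ]
    (0ℚ < c × 0ℚ < K ×
    (∀ (d : ℕ) .{{_ : NonZero d}} →
    ∣ fromℕ (i (Hmod d)) - fromℕ (3 ℕ.* 4 ℕ.^ d) - fromℕ (d ℕ.* 3 ℕ.^ (d ℕ.+ 1)) ∣
    ≤ K * (fromℕ 3 - c) ^ℚ d) ×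
    (Σ[ C ∈ ℚ ]
    (0ℚ < C ×
    (∀ (d : ℕ) .{{_ : NonZero d}} →
    ∣ fromℕ (i (Hmod d)) - fromℕ (3 ℕ.* 4 ℕ.^ d) ∣
    ≤ C * (fromℕ 4 - c) ^ℚ d))))
theorem1 =
  + 1 / 50 , fromℕ (suc K) , ℚₚ.positive⁻¹ (+ 1 / 50) , 0<fromℕ-suc K ,
  (λ d → first-order K d (i (Hmod d)) (estimate d)) ,
  fromℕ (suc (3 ℕ.* K₁ ℕ.+ K)) , 0<fromℕ-suc (3 ℕ.* K₁ ℕ.+ K) ,
  (λ d → zeroth-order K d (i (Hmod d)) (estimate d) K₁ (linear d))
  where
  K K₁ : ℕ
  K  = proj₁ Hmod-estimate
  K₁ = proj₁ linear≤exp
  estimate : ∀ d .{{_ : NonZero d}} → Estimate K d (i (Hmod d))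
  estimate = proj₂ Hmod-estimate
  linear : ∀ d → suc d ℕ.^ 1 ℕ.* 150 ℕ.^ d ℕ.≤ K₁ ℕ.* 199 ℕ.^ d
  linear = proj₂ linear≤exp
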